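{- Let $p$ be a prime with $p\equiv 1\pmod 4$ and let $\alpha$ be a positive integer. Then the number of complete subgraphs of order $3$ in $G_{p^\alpha}$ is $$\mathcal{K}_3(G_{p^{\alpha}})=\frac{p^{3\alpha-2}(p-1)(p-5)}{48}.$$
   Context: For a positive integer $n$, $\mathbb{Z}_n$ denotes the ring of integers modulo $n$ and $\mathbb{Z}_n^{\ast}$ its group of units. The graph $G_n$ has vertex set $\mathbb{Z}_n$, and two distinct vertices $a,b$ are adjacent if and only if $a-b\equiv x^2\pmod n$ for some $x\in\mathbb{Z}_n^{\ast}$ (for $n=p^\alpha$ with $p\equiv1\pmod4$, $-1$ is a square of a unit, so this relation is symmetric). For a graph $G$, $\mathcal{K}_m(G)$ denotes the number of complete subgraphs of order $m$ in $G$. -}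

module Defs where

open import Data.Nat using (ℕ; zero; suc; _+_; _*_; _∸_; _<_; _≟_; NonZero)
open import Data.Nat.Properties using (_<?_)
open import Data.Nat.DivMod using (_%_)
open import Data.Nat.Coprimality using (Coprime; coprime?)
open import Data.List using (List; []; _∷_; upTo; filter; length; concatMap)
open import Data.List.Relation.Unary.Any using (Any; any?)
open import Data.Product using (_×_; _,_; Σ; ∃)
open import Relation.Binary.PropositionalEquality using (_≡_)
open import Relation.Nullary using (Dec; ¬_)
open import Relation.Nullary.Decidable using (_×-dec_; ¬?)

-- Residues modulo n are represented by naturals a < n.
-- (a - b) mod n, computed in ℕ as (a + (n ∸ b)) % n, valid for b < n.
diffMod : (n : ℕ) → .{{_ : NonZero n}} → ℕ → ℕ → ℕ
diffMod n a b = (a + (n ∸ b)) % n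

IsUnitSquare : (n : ℕ) → .{{_ : NonZero n}} → ℕ → Set
IsUnitSquare n d = Any (λ x → Coprime x n × ((x * x) % n ≡ d % n)) (upTo n)

isUnitSquare? : (n : ℕ) → .{{_ : NonZero n}} → (d : ℕ) → Dec (IsUnitSquare n d)
isUnitSquare? n d = any? (λ x → coprime? x n ×-dec ((x * x) % n ≟ d % n)) (upTo n)

Adj : (n : ℕ) → .{{_ : NonZero n}} → ℕ → ℕ → Set
Adj n a b = (¬ a ≡ b) × IsUnitSquare n (diffMod n a b)

adj? : (n : ℕ) → .{{_ : NonZero n}} → (a b : ℕ) → Dec (Adj n a b)
adj? n a b = ¬? (a ≟ b) ×-dec isUnitSquare? n (diffMod n a b)

-- All triples (a , b , c) with a < b < c < n (each listed once), i.e. all 3-element vertex subsets.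
triples : ℕ → List (ℕ × ℕ × ℕ)
triples n = concatMap (λ c → concatMap (λ b → Data.List.map (λ a → (a , b , c)) (upTo b)) (upTo c)) (upTo n)

IsTriangle : (n : ℕ) → .{{_ : NonZero n}} → ℕ × ℕ × ℕ → Set
IsTriangle n (a , b , c) = Adj n a b × Adj n a c × Adj n b c

isTriangle? : (n : ℕ) → .{{_ : NonZero n}} → (t : ℕ × ℕ × ℕ) → Dec (IsTriangle n t)
isTriangle? n (a , b , c) = adj? n a b ×-dec (adj? n a c ×-dec adj? n b c)

K3 : (n : ℕ) → .{{_ : NonZero n}} → ℕ
K3 n = length (filter (isTriangle? n) (triples n))

{-# OPTIONS --safe #-}
module Submission where

{- Write n = p^α and let χ be the indicator of the set of squares of units modulo n. A unit
   square has exactly two roots, so sums weighted by 2χ turn into sums over units. Since -1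
   is a square, the triangle indicator χ(a-b) χ(a-c) χ(b-c) is symmetric, and by translation

     48 K₃ = 8 ∑_{a,b,c} χ(a-b) χ(a-c) χ(b-c) = n #{ units x, y, z : x² - y² = z² }
           = n φ(n) #{ units x, z : x² - 1 = z² }.

   Solutions (x , z) correspond to w = x + z such that w, w² + 1 and w² - 1 are units, that is,
   w avoids the five residues 0, ±1, ±√-1 modulo p; there are p^(α-1) (p - 5) of these. -}

open import Defs
open import Data.Nat
open import Data.Nat.Properties
open import Data.Nat.DivMod using (m%n<n; m≡m%n+[m/n]*n; m*n/n≡m)
import Data.Nat.Divisibility as ℕ∣
open import Data.Nat.Coprimality using (Coprime; coprime-divisor; coprime-Bézout)
open import Data.Nat.GCD using (module Bézout)
open import Data.Nat.Primality using (Prime; prime⇒nonZero; prime⇒irreducible; euclidsLemma; ¬prime[1])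
import Data.Nat.Tactic.RingSolver as ℕ-Solver
open import Data.Integer as ℤ using (ℤ; +_)
import Data.Integer.Properties as ℤ
import Data.Integer.DivMod as ℤ
open import Data.Integer.Divisibility.Signed
  using (_∣_; divides; _∣?_; ∣⇒∣ᵤ; ∣ᵤ⇒∣; ∣-trans; ∣m∣n⇒∣m+n; ∣n⇒∣m*n)
import Data.Integer.Tactic.RingSolver as ℤ-Solver
open import Algebra.Properties.CommutativeSemigroup +-commutativeSemigroup using (interchange)
open import Data.List using (List; []; _∷_; _++_; map; upTo; filter; length; concatMap)
open import Data.List.Properties
  using (upTo-∷ʳ; concatMap-++; filter-++; length-++; map-++; ++-identityʳ)
open import Data.List.Membership.Propositional using (lose)
open import Data.List.Membership.Propositional.Properties using (∈-upTo⁺)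
open import Data.List.Relation.Unary.All as All using (All; []; _∷_; all?)
open import Data.List.Relation.Unary.AllPairs using (AllPairs; []; _∷_)
open import Data.List.Relation.Unary.Any using (satisfied)
open import Data.Product using (_×_; _,_; proj₁; proj₂; ∃)
open import Data.Sum using (_⊎_; inj₁; inj₂)
open import Function using (_∘_)
open import Relation.Nullary using (Dec; yes; no; ¬_; contradiction)
open import Relation.Nullary.Decidable using (map′; decidable-stable; ¬?; _×-dec_)
open import Relation.Binary.PropositionalEquality

-- Vertices are naturals below `n`, while the substitutions need differences and negatives. The
-- weights are therefore functions on ℤ that are constant on the classes modulo `n`, summed over 0,
-- ..., n - 1, and a change of variables is any map invertible modulo `n`. The count is kept free of
-- division: each of the three factors χ carries its own 2, so that 48 = 6 · 8, where 6 is the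
-- number of orderings of a triangle. The parameter w comes from factoring x² - z² = (x - z)(x + z)
-- = 1. It is a unit with inverse x - z, so 2x = w + w⁻¹ and 2z = w - w⁻¹; hence x and z are units
-- exactly when w² + 1 and w² - 1 are. Points on a conic become residues to be avoided, and no
-- character sums occur. A root i of -1 serves twice: it makes adjacency symmetric, and it supplies
-- two of the five avoided residues. Its existence is drawn from a parity count, without the cyclic
-- structure of the unit group. With `β` = α - 1, the factor `p ^ β` is the number of lifts of a
-- residue modulo p to residues modulo n.

𝟙 : ∀ {a} {P : Set a} → Dec P → ℕ
𝟙 (yes _) = 1
𝟙 (no  _) = 0

module _ {a} {P : Set a} where

  𝟙-yes : (P? : Dec P) → P → 𝟙 P? ≡ 1
  𝟙-yes (yes _) _ = refl
  𝟙-yes (no ¬p) p = contradiction p ¬p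

  𝟙-no : (P? : Dec P) → ¬ P → 𝟙 P? ≡ 0
  𝟙-no (yes p) ¬p = contradiction p ¬p
  𝟙-no (no _)  _  = refl

  -- Where `P` fails both sides are 0, so a fact about units or squares alone may be used inside a
  -- sum over all residues.
  𝟙-*-cong : (P? : Dec P) {x y : ℕ} → (P → x ≡ y) → 𝟙 P? * x ≡ 𝟙 P? * y
  𝟙-*-cong (yes p) x≡y = cong (1 *_) (x≡y p)
  𝟙-*-cong (no _)  _   = refl

module _ {a b} {P : Set a} {Q : Set b} where

  𝟙-⇔ : (P? : Dec P) (Q? : Dec Q) → (P → Q) → (Q → P) → 𝟙 P? ≡ 𝟙 Q?
  𝟙-⇔ (yes p) Q? to from = sym (𝟙-yes Q? (to p))
  𝟙-⇔ (no ¬p) Q? to from = sym (𝟙-no Q? (¬p ∘ from))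

  𝟙-× : (P? : Dec P) (Q? : Dec Q) → 𝟙 (P? ×-dec Q?) ≡ 𝟙 P? * 𝟙 Q?
  𝟙-× (yes _) (yes _) = refl
  𝟙-× (yes _) (no _)  = refl
  𝟙-× (no _)  (yes _) = refl
  𝟙-× (no _)  (no _)  = refl

-- Finite sums of natural numbers.

∑ : ℕ → (ℕ → ℕ) → ℕ
∑ zero    f = 0
∑ (suc n) f = ∑ n f + f n

∑-cong-< : ∀ n {f g} → (∀ i → i < n → f i ≡ g i) → ∑ n f ≡ ∑ n g
∑-cong-< zero    f≗g = refl
∑-cong-< (suc n) f≗g =
  cong₂ _+_ (∑-cong-< n λ i i<n → f≗g i (m<n⇒m<1+n i<n)) (f≗g n ≤-refl)

∑-cong : ∀ n {f g} → (∀ i → f i ≡ g i) → ∑ n f ≡ ∑ n g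
∑-cong n f≗g = ∑-cong-< n λ i _ → f≗g i

∑-const : ∀ n c → ∑ n (λ _ → c) ≡ n * c
∑-const zero    c = refl
∑-const (suc n) c = trans (cong (_+ c) (∑-const n c)) (+-comm (n * c) c)

∑-zero : ∀ n {f} → (∀ i → f i ≡ 0) → ∑ n f ≡ 0
∑-zero n f≗0 = trans (∑-cong n f≗0) (trans (∑-const n 0) (*-zeroʳ n))

∑-+ : ∀ n f g → ∑ n (λ i → f i + g i) ≡ ∑ n f + ∑ n g
∑-+ zero    f g = refl
∑-+ (suc n) f g = trans (cong (_+ (f n + g n)) (∑-+ n f g)) (interchange (∑ n f) (∑ n g) (f n) (g n))

∑-*ˡ : ∀ n c f → ∑ n (λ i → c * f i) ≡ c * ∑ n f
∑-*ˡ zero    c f = sym (*-zeroʳ c)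
∑-*ˡ (suc n) c f = trans (cong (_+ c * f n) (∑-*ˡ n c f)) (sym (*-distribˡ-+ c (∑ n f) (f n)))

∑-*ʳ : ∀ n c f → ∑ n (λ i → f i * c) ≡ ∑ n f * c
∑-*ʳ n c f = trans (∑-cong n λ i → *-comm (f i) c) (trans (∑-*ˡ n c f) (*-comm c (∑ n f)))

∑-swap : ∀ m n (f : ℕ → ℕ → ℕ) → ∑ m (λ i → ∑ n (f i)) ≡ ∑ n (λ j → ∑ m (λ i → f i j))
∑-swap zero    n f = sym (∑-zero n λ _ → refl)
∑-swap (suc m) n f = trans (cong (_+ ∑ n (f m)) (∑-swap m n f)) (sym (∑-+ n _ (f m)))

∑-++ : ∀ m n f → ∑ (m + n) f ≡ ∑ m f + ∑ n (λ i → f (m + i))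
∑-++ m zero    f = trans (cong (λ k → ∑ k f) (+-identityʳ m)) (sym (+-identityʳ (∑ m f)))
∑-++ m (suc n) f = begin
  ∑ (m + suc n) f                                ≡⟨ cong (λ k → ∑ k f) (+-suc m n) ⟩
  ∑ (m + n) f + f (m + n)                        ≡⟨ cong (_+ f (m + n)) (∑-++ m n f) ⟩
  ∑ m f + ∑ n (λ i → f (m + i)) + f (m + n)      ≡⟨ +-assoc (∑ m f) _ _ ⟩
  ∑ m f + (∑ n (λ i → f (m + i)) + f (m + n))    ∎
  where open ≡-Reasoning

∑-single : ∀ {n r} → r < n → ∀ f → (∀ i → i < n → i ≢ r → f i ≡ 0) → ∑ n f ≡ f r
∑-single {suc n} {r} r<1+n f f≗0 with r ≟ n
... | yes refl = cong (_+ f n) (trans (∑-cong-< n λ i i<n → f≗0 i (m<n⇒m<1+n i<n) (<⇒≢ i<n))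
                                      (∑-zero n λ _ → refl))
... | no r≢n = trans (cong₂ _+_ (∑-single (≤∧≢⇒< (s≤s⁻¹ r<1+n) r≢n) f λ i i<n → f≗0 i (m<n⇒m<1+n i<n))
                                (f≗0 n ≤-refl (r≢n ∘ sym)))
                     (+-identityʳ (f r))

-- Lengths of filtered lists as sums of indicators.

module _ {a p} {A : Set a} {P : A → Set p} (P? : ∀ x → Dec (P x)) where

  length-filter-[] : ∀ x → length (filter P? (x ∷ [])) ≡ 𝟙 (P? x)
  length-filter-[] x with P? x
  ... | yes _ = refl
  ... | no  _ = refl

  length-filter-++ : ∀ xs ys → length (filter P? (xs ++ ys)) ≡ length (filter P? xs) + length (filter P? ys)
  length-filter-++ xs ys = trans (cong length (filter-++ P? xs ys)) (length-++ (filter P? xs))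

  length-filter-map : ∀ (f : ℕ → A) n → length (filter P? (map f (upTo n))) ≡ ∑ n (λ i → 𝟙 (P? (f i)))
  length-filter-map f zero    = refl
  length-filter-map f (suc n) = begin
    -- `∑` peels off its last term, so `upTo (suc n)` is split at its right end.
    length (filter P? (map f (upTo (suc n))))         ≡⟨ cong (length ∘ filter P? ∘ map f) (upTo-∷ʳ n) ⟨
    length (filter P? (map f (upTo n ++ n ∷ [])))     ≡⟨ cong (length ∘ filter P?) (map-++ f (upTo n) (n ∷ [])) ⟩
    length (filter P? (map f (upTo n) ++ f n ∷ []))   ≡⟨ length-filter-++ (map f (upTo n)) (f n ∷ []) ⟩
    length (filter P? (map f (upTo n))) + length (filter P? (f n ∷ []))
                                                      ≡⟨ cong₂ _+_ (length-filter-map f n) (length-filter-[] (f n)) ⟩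
    ∑ n (λ i → 𝟙 (P? (f i))) + 𝟙 (P? (f n))           ∎
    where open ≡-Reasoning

  length-filter-concatMap : ∀ (f : ℕ → List A) n →
    length (filter P? (concatMap f (upTo n))) ≡ ∑ n (λ i → length (filter P? (f i)))
  length-filter-concatMap f zero    = refl
  length-filter-concatMap f (suc n) = begin
    length (filter P? (concatMap f (upTo (suc n))))
      ≡⟨ cong (length ∘ filter P? ∘ concatMap f) (upTo-∷ʳ n) ⟨
    length (filter P? (concatMap f (upTo n ++ n ∷ [])))
      ≡⟨ cong (length ∘ filter P?) (concatMap-++ f (upTo n) (n ∷ [])) ⟩
    length (filter P? (concatMap f (upTo n) ++ (f n ++ [])))
      ≡⟨ length-filter-++ (concatMap f (upTo n)) (f n ++ []) ⟩
    length (filter P? (concatMap f (upTo n))) + length (filter P? (f n ++ []))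
      ≡⟨ cong₂ _+_ (length-filter-concatMap f n) (cong (length ∘ filter P?) (++-identityʳ (f n))) ⟩
    ∑ n (λ i → length (filter P? (f i))) + length (filter P? (f n)) ∎
    where open ≡-Reasoning

-- Sums of symmetric functions over squares and cubes of indices.

∑-symmetric₂ : ∀ n (f : ℕ → ℕ → ℕ) → (∀ i j → f i j ≡ f j i) →
  ∑ n (λ j → ∑ n (λ i → f i j)) ≡ 2 * ∑ n (λ j → ∑ j (λ i → f i j)) + ∑ n (λ i → f i i)
∑-symmetric₂ zero    f f-sym = refl
∑-symmetric₂ (suc n) f f-sym = begin
  ∑ n (λ j → ∑ n (λ i → f i j) + f n j) + (column + f n n)
    ≡⟨ cong (_+ (column + f n n)) (∑-+ n _ (f n)) ⟩
  square + ∑ n (f n) + (column + f n n)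
    ≡⟨ cong₂ (λ s c → s + c + (column + f n n)) (∑-symmetric₂ n f f-sym) (∑-cong n (f-sym n)) ⟩
  2 * below + diagonal + column + (column + f n n)
    ≡⟨ rearrange below diagonal column (f n n) ⟩
  2 * (below + column) + (diagonal + f n n) ∎
  where
  open ≡-Reasoning
  square   = ∑ n (λ j → ∑ n (λ i → f i j))
  below    = ∑ n (λ j → ∑ j (λ i → f i j))
  diagonal = ∑ n (λ i → f i i)
  column   = ∑ n (λ i → f i n)
  rearrange : ∀ b d c e → 2 * b + d + c + (c + e) ≡ 2 * (b + c) + (d + e)
  rearrange = ℕ-Solver.solve-∀

-- The two transpositions generate all six orderings, and with them the one vanishing diagonal kills
-- every triple with a repeated index. Enlarging the cube by the index n adds three faces, all equal
-- to `layer n` by symmetry, together with edges and a corner that vanish. Each face is twice its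
-- triangular half, hence 3 · 2 = 6.
∑-symmetric₃ : ∀ n (f : ℕ → ℕ → ℕ → ℕ) →
  (∀ i j k → f i j k ≡ f j i k) → (∀ i j k → f i j k ≡ f i k j) → (∀ i k → f i i k ≡ 0) →
  ∑ n (λ k → ∑ n (λ j → ∑ n (λ i → f i j k))) ≡ 6 * ∑ n (λ k → ∑ k (λ j → ∑ j (λ i → f i j k)))
∑-symmetric₃ zero    f f-sym₁₂ f-sym₂₃ f-diag = refl
∑-symmetric₃ (suc n) f f-sym₁₂ f-sym₂₃ f-diag = begin
  ∑ n (λ k → ∑ (suc n) (λ j → ∑ (suc n) (λ i → f i j k))) + ∑ (suc n) (λ j → ∑ (suc n) (λ i → f i j n))
    ≡⟨ cong₂ _+_ (∑-cong n slice) (slice n) ⟩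
  ∑ n (λ k → layer k + row k + column k) + (layer n + row n + column n)
    ≡⟨ cong₂ _+_ (trans (∑-+ n _ column) (cong (_+ ∑ n column) (∑-+ n layer row)))
                 (cong₂ (λ r c → layer n + r + c) row≡0 column≡0) ⟩
  ∑ n layer + ∑ n row + ∑ n column + (layer n + 0 + 0)
    ≡⟨ cong₂ (λ r c → ∑ n layer + r + c + (layer n + 0 + 0)) ∑-row ∑-column ⟩
  ∑ n layer + layer n + layer n + (layer n + 0 + 0)
    ≡⟨ cong₂ (λ l m → l + m + m + (m + 0 + 0)) (∑-symmetric₃ n f f-sym₁₂ f-sym₂₃ f-diag) layer≡ ⟩
  6 * below₃ + (2 * below₂ + 0) + (2 * below₂ + 0) + ((2 * below₂ + 0) + 0 + 0)
    ≡⟨ rearrange below₃ below₂ ⟩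
  6 * (below₃ + below₂) ∎
  where
  open ≡-Reasoning
  layer row column : ℕ → ℕ
  layer k  = ∑ n (λ j → ∑ n (λ i → f i j k))
  row k    = ∑ n (λ j → f n j k)
  column k = ∑ n (λ i → f i n k)
  below₂   = ∑ n (λ j → ∑ j (λ i → f i j n))
  below₃   = ∑ n (λ k → ∑ k (λ j → ∑ j (λ i → f i j k)))
  rearrange : ∀ b t → 6 * b + (2 * t + 0) + (2 * t + 0) + ((2 * t + 0) + 0 + 0) ≡ 6 * (b + t)
  rearrange = ℕ-Solver.solve-∀
  slice : ∀ k → ∑ (suc n) (λ j → ∑ (suc n) (λ i → f i j k)) ≡ layer k + row k + column k
  slice k = begin
    ∑ n (λ j → ∑ n (λ i → f i j k) + f n j k) + (column k + f n n k)
      ≡⟨ cong₂ (λ s z → s + (column k + z)) (∑-+ n _ (λ j → f n j k)) (f-diag n k) ⟩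
    layer k + row k + (column k + 0)
      ≡⟨ cong (λ s → layer k + row k + s) (+-identityʳ (column k)) ⟩
    layer k + row k + column k ∎
  row≡0 : row n ≡ 0
  row≡0 = ∑-zero n λ j → trans (f-sym₂₃ n j n) (f-diag n j)
  column≡0 : column n ≡ 0
  column≡0 = ∑-zero n λ i → trans (f-sym₁₂ i n n) (row-entry i)
    where row-entry : ∀ i → f n i n ≡ 0
          row-entry i = trans (f-sym₂₃ n i n) (f-diag n i)
  ∑-row : ∑ n row ≡ layer n
  ∑-row = ∑-cong n λ k → ∑-cong n λ j → trans (f-sym₁₂ n j k) (f-sym₂₃ j n k)
  ∑-column : ∑ n column ≡ layer n
  ∑-column = ∑-cong n λ k → ∑-cong n λ i → f-sym₂₃ i n k
  layer≡ : layer n ≡ 2 * below₂ + 0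
  layer≡ = trans (∑-symmetric₂ n (λ i j → f i j n) (λ i j → f-sym₁₂ i j n))
                 (cong (λ s → 2 * below₂ + s) (∑-zero n λ i → f-diag i n))

-- Congruence of integers modulo n.

neg-square : ∀ x → ℤ.- x ℤ.* ℤ.- x ≡ x ℤ.* x
neg-square = ℤ-Solver.solve-∀

∣-multiple : ∀ {d a c} s → d ∣ a → c ≡ s ℤ.* a → d ∣ c
∣-multiple s d∣a c≡ = subst (_ ∣_) (sym c≡) (∣n⇒∣m*n s d∣a)

∣-combination : ∀ {d a b c} s t → d ∣ a → d ∣ b → c ≡ s ℤ.* a ℤ.+ t ℤ.* b → d ∣ c
∣-combination s t d∣a d∣b c≡ = subst (_ ∣_) (sym c≡) (∣m∣n⇒∣m+n (∣n⇒∣m*n s d∣a) (∣n⇒∣m*n t d∣b))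

infix 4 _≈_[_] _≈?_[_]

-- A record keeps `a` and `b` readable from the type; bare divisibility would hide them behind the
-- subtraction.
record _≈_[_] (a b : ℤ) (n : ℕ) : Set where
  constructor mk≈
  field n∣a-b : + n ∣ a ℤ.- b

open _≈_[_] public

abstract

  _≈?_[_] : ∀ a b n → Dec (a ≈ b [ n ])
  a ≈? b [ n ] = map′ mk≈ n∣a-b (+ n ∣? (a ℤ.- b))

module _ {n : ℕ} where

  ≈-reflexive : ∀ {a b} → a ≡ b → a ≈ b [ n ]
  ≈-reflexive {a} refl = mk≈ (divides (+ 0) (ℤ.+-inverseʳ a))

  ≈-refl : ∀ {a} → a ≈ a [ n ]
  ≈-refl = ≈-reflexive refl

  ≈-sym : ∀ {a b} → a ≈ b [ n ] → b ≈ a [ n ]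
  ≈-sym {a} {b} (mk≈ a≈b) = mk≈ (∣-multiple (ℤ.- (+ 1)) a≈b (identity a b))
    where identity : ∀ a b → b ℤ.- a ≡ ℤ.- (+ 1) ℤ.* (a ℤ.- b)
          identity = ℤ-Solver.solve-∀

  ≈-trans : ∀ {a b c} → a ≈ b [ n ] → b ≈ c [ n ] → a ≈ c [ n ]
  ≈-trans {a} {b} {c} (mk≈ a≈b) (mk≈ b≈c) = mk≈ (∣-combination (+ 1) (+ 1) a≈b b≈c (identity a b c))
    where identity : ∀ a b c → a ℤ.- c ≡ + 1 ℤ.* (a ℤ.- b) ℤ.+ + 1 ℤ.* (b ℤ.- c)
          identity = ℤ-Solver.solve-∀

  +-cong-≈ : ∀ {a b c d} → a ≈ b [ n ] → c ≈ d [ n ] → a ℤ.+ c ≈ b ℤ.+ d [ n ]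
  +-cong-≈ {a} {b} {c} {d} (mk≈ a≈b) (mk≈ c≈d) = mk≈ (∣-combination (+ 1) (+ 1) a≈b c≈d (identity a b c d))
    where identity : ∀ a b c d → a ℤ.+ c ℤ.- (b ℤ.+ d) ≡ + 1 ℤ.* (a ℤ.- b) ℤ.+ + 1 ℤ.* (c ℤ.- d)
          identity = ℤ-Solver.solve-∀

  *-cong-≈ : ∀ {a b c d} → a ≈ b [ n ] → c ≈ d [ n ] → a ℤ.* c ≈ b ℤ.* d [ n ]
  *-cong-≈ {a} {b} {c} {d} (mk≈ a≈b) (mk≈ c≈d) = mk≈ (∣-combination c b a≈b c≈d (identity a b c d))
    where identity : ∀ a b c d → a ℤ.* c ℤ.- b ℤ.* d ≡ c ℤ.* (a ℤ.- b) ℤ.+ b ℤ.* (c ℤ.- d)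
          identity = ℤ-Solver.solve-∀

  -‿cong-≈ : ∀ {a b} → a ≈ b [ n ] → ℤ.- a ≈ ℤ.- b [ n ]
  -‿cong-≈ {a} {b} (mk≈ a≈b) = mk≈ (∣-multiple (ℤ.- (+ 1)) a≈b (identity a b))
    where identity : ∀ a b → ℤ.- a ℤ.- (ℤ.- b) ≡ ℤ.- (+ 1) ℤ.* (a ℤ.- b)
          identity = ℤ-Solver.solve-∀

  minus-cong-≈ : ∀ {a b c d} → a ≈ b [ n ] → c ≈ d [ n ] → a ℤ.- c ≈ b ℤ.- d [ n ]
  minus-cong-≈ a≈b c≈d = +-cong-≈ a≈b (-‿cong-≈ c≈d)

  ≈-divisor : ∀ {d a b} → + d ∣ + n → a ≈ b [ n ] → a ≈ b [ d ]
  ≈-divisor d∣n (mk≈ a≈b) = mk≈ (∣-trans d∣n a≈b)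

private
  <-unique-≤ : ∀ {n i j} → i ≤ j → j < n → + i ≈ + j [ n ] → i ≡ j
  <-unique-≤ {n} {i} {j} i≤j j<n (mk≈ i≈j) with j ∸ i in eq
  ... | zero  = ≤-antisym i≤j (m∸n≡0⇒m≤n eq)
  ... | suc k = contradiction n∣1+k (ℕ∣.>⇒∤ (subst (_< n) eq (≤-<-trans (m∸n≤m j i) j<n)))
    where
    n∣1+k : n ℕ∣.∣ suc k
    n∣1+k = subst (n ℕ∣.∣_) (trans (cong ℤ.∣_∣ (ℤ.m-n≡m⊖n i j)) (trans (ℤ.∣⊖∣-≤ i≤j) eq)) (∣⇒∣ᵤ i≈j)

<-unique : ∀ {n i j} → i < n → j < n → + i ≈ + j [ n ] → i ≡ j
<-unique {n} {i} {j} i<n j<n i≈j with ≤-total i j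
... | inj₁ i≤j = <-unique-≤ i≤j j<n i≈j
... | inj₂ j≤i = sym (<-unique-≤ j≤i i<n (≈-sym i≈j))

%ℕ-≈ : ∀ a n .{{_ : NonZero n}} → + (a ℤ.%ℕ n) ≈ a [ n ]
%ℕ-≈ a n = ≈-sym (mk≈ (divides (a ℤ./ℕ n) (begin
  a ℤ.- + r                          ≡⟨ cong (ℤ._- + r) (ℤ.a≡a%ℕn+[a/ℕn]*n a n) ⟩
  + r ℤ.+ a ℤ./ℕ n ℤ.* + n ℤ.- + r   ≡⟨ identity (+ r) (a ℤ./ℕ n ℤ.* + n) ⟩
  a ℤ./ℕ n ℤ.* + n                   ∎)))
  where
  open ≡-Reasoning
  r = a ℤ.%ℕ n
  identity : ∀ x y → x ℤ.+ y ℤ.- x ≡ y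
  identity = ℤ-Solver.solve-∀

%≡⇒≈ : ∀ a b n .{{_ : NonZero n}} → a % n ≡ b % n → + a ≈ + b [ n ]
%≡⇒≈ a b n eq = ≈-trans (≈-sym (%ℕ-≈ (+ a) n)) (≈-trans (≈-reflexive (cong +_ eq)) (%ℕ-≈ (+ b) n))

≈⇒%≡ : ∀ a b n .{{_ : NonZero n}} → + a ≈ + b [ n ] → a % n ≡ b % n
≈⇒%≡ a b n a≈b = <-unique (m%n<n a n) (m%n<n b n)
  (≈-trans (%ℕ-≈ (+ a) n) (≈-trans a≈b (≈-sym (%ℕ-≈ (+ b) n))))

-- Sums of periodic functions over a full set of residues.

Periodic : ℕ → (ℤ → ℕ) → Set
Periodic n F = ∀ {a b} → a ≈ b [ n ] → F a ≡ F b

∑ᶻ : ℕ → (ℤ → ℕ) → ℕ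
∑ᶻ n F = ∑ n (λ i → F (+ i))

∑ᶻ-cong : ∀ n {F G} → (∀ x → F x ≡ G x) → ∑ᶻ n F ≡ ∑ᶻ n G
∑ᶻ-cong n F≗G = ∑-cong n λ i → F≗G (+ i)

∑ᶻ-swap : ∀ m n (F : ℤ → ℤ → ℕ) → ∑ᶻ m (λ x → ∑ᶻ n (F x)) ≡ ∑ᶻ n (λ y → ∑ᶻ m (λ x → F x y))
∑ᶻ-swap m n F = ∑-swap m n λ i j → F (+ i) (+ j)

𝟙-periodic : ∀ {n} {P : ℤ → Set} (P? : ∀ x → Dec (P x)) →
  (∀ {a b} → a ≈ b [ n ] → P a → P b) → Periodic n (λ x → 𝟙 (P? x))
𝟙-periodic P? P-resp {a} {b} a≈b = 𝟙-⇔ (P? a) (P? b) (P-resp a≈b) (P-resp (≈-sym a≈b))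

module _ (n : ℕ) .{{_ : NonZero n}} where

  -- Only the representative `a %ℕ n` contributes; periodicity carries the value back to `a`, which
  -- may lie outside the range of summation.
  ∑ᶻ-δ : ∀ {F} → Periodic n F → ∀ a → ∑ᶻ n (λ x → 𝟙 (x ≈? a [ n ]) * F x) ≡ F a
  ∑ᶻ-δ {F} F-per a = begin
    ∑ᶻ n (λ x → 𝟙 (x ≈? a [ n ]) * F x)   ≡⟨ ∑-single (ℤ.n%ℕd<d a n) _ off-diagonal ⟩
    𝟙 (+ r ≈? a [ n ]) * F (+ r)          ≡⟨ cong (_* F (+ r)) (𝟙-yes (+ r ≈? a [ n ]) (%ℕ-≈ a n)) ⟩
    1 * F (+ r)                           ≡⟨ *-identityˡ (F (+ r)) ⟩
    F (+ r)                               ≡⟨ F-per (%ℕ-≈ a n) ⟩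
    F a                                   ∎
    where
    open ≡-Reasoning
    r = a ℤ.%ℕ n
    off-diagonal : ∀ i → i < n → i ≢ r → 𝟙 (+ i ≈? a [ n ]) * F (+ i) ≡ 0
    off-diagonal i i<n i≢r = cong (_* F (+ i)) (𝟙-no (+ i ≈? a [ n ]) λ i≈a →
      i≢r (<-unique i<n (ℤ.n%ℕd<d a n) (≈-trans i≈a (≈-sym (%ℕ-≈ a n)))))

  ∑ᶻ-𝟙≈ : ∀ a → ∑ᶻ n (λ x → 𝟙 (x ≈? a [ n ])) ≡ 1
  ∑ᶻ-𝟙≈ a = trans (∑ᶻ-cong n λ x → sym (*-identityʳ (𝟙 (x ≈? a [ n ])))) (∑ᶻ-δ (λ _ → refl) a)

  -- The two hypotheses make y ≡ g x the graph of a bijection of residues. Each F (g x) is expanded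
  -- as a delta sum over y; after exchanging the sums, every y is met by the single class x ≡ h y.
  ∑ᶻ-permute : ∀ (g h : ℤ → ℤ) →
    (∀ {x y} → y ≈ g x [ n ] → x ≈ h y [ n ]) → (∀ {x y} → x ≈ h y [ n ] → y ≈ g x [ n ]) →
    ∀ {F} → Periodic n F → ∑ᶻ n (λ x → F (g x)) ≡ ∑ᶻ n F
  ∑ᶻ-permute g h to from {F} F-per = begin
    ∑ᶻ n (λ x → F (g x))
      ≡⟨ ∑ᶻ-cong n (λ x → ∑ᶻ-δ F-per (g x)) ⟨
    ∑ᶻ n (λ x → ∑ᶻ n (λ y → 𝟙 (y ≈? g x [ n ]) * F y))
      ≡⟨ ∑-swap n n _ ⟩
    ∑ᶻ n (λ y → ∑ᶻ n (λ x → 𝟙 (y ≈? g x [ n ]) * F y))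
      ≡⟨ ∑-cong n (λ j → ∑-*ʳ n (F (+ j)) _) ⟩
    ∑ᶻ n (λ y → ∑ᶻ n (λ x → 𝟙 (y ≈? g x [ n ])) * F y)
      ≡⟨ ∑ᶻ-cong n (λ y → cong (_* F y) (fibre y)) ⟩
    ∑ᶻ n (λ y → 1 * F y)
      ≡⟨ ∑ᶻ-cong n (λ y → *-identityˡ (F y)) ⟩
    ∑ᶻ n F ∎
    where
    open ≡-Reasoning
    fibre : ∀ y → ∑ᶻ n (λ x → 𝟙 (y ≈? g x [ n ])) ≡ 1
    fibre y = trans (∑ᶻ-cong n λ x → 𝟙-⇔ (y ≈? g x [ n ]) (x ≈? h y [ n ]) to from) (∑ᶻ-𝟙≈ (h y))

∑ᶻ-periods : ∀ p m {F} → Periodic p F → ∑ᶻ (m * p) F ≡ m * ∑ᶻ p F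
∑ᶻ-periods p zero    F-per = refl
∑ᶻ-periods p (suc m) {F} F-per = begin
  ∑ᶻ (p + m * p) F                               ≡⟨ ∑-++ p (m * p) _ ⟩
  ∑ᶻ p F + ∑ (m * p) (λ i → F (+ (p + i)))       ≡⟨ cong (λ s → ∑ᶻ p F + s) (∑-cong (m * p) λ i → F-per (shift i)) ⟩
  ∑ᶻ p F + ∑ᶻ (m * p) F                          ≡⟨ cong (λ s → ∑ᶻ p F + s) (∑ᶻ-periods p m F-per) ⟩
  ∑ᶻ p F + m * ∑ᶻ p F                            ∎
  where
  open ≡-Reasoning
  identity : ∀ x y → x ℤ.+ y ℤ.- y ≡ + 1 ℤ.* x
  identity = ℤ-Solver.solve-∀
  shift : ∀ i → + (p + i) ≈ + i [ p ]
  shift i = mk≈ (divides (+ 1) (trans (cong (ℤ._- + i) (ℤ.pos-+ p i)) (identity (+ p) (+ i))))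

-- Since `a` is incongruent to every member of `as`, its class is the only one that avoids `as` but
-- not `a ∷ as`, so each entry costs exactly one residue. The additive form keeps truncated
-- subtraction out of the induction.
∑ᶻ-avoiding : ∀ m .{{_ : NonZero m}} {as} → AllPairs (λ a b → ¬ a ≈ b [ m ]) as →
  ∑ᶻ m (λ x → 𝟙 (all? (λ a → ¬? (x ≈? a [ m ])) as)) + length as ≡ m
∑ᶻ-avoiding m [] = trans (+-identityʳ _) (trans (∑-const m 1) (*-identityʳ m))
∑ᶻ-avoiding m {a ∷ as} (a≉as ∷ as≉) = begin
  ∑ᶻ m (λ x → 𝟙 (avoids? (a ∷ as) x)) + (1 + length as)
    ≡⟨ +-assoc (∑ᶻ m (λ x → 𝟙 (avoids? (a ∷ as) x))) 1 (length as) ⟨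
  ∑ᶻ m (λ x → 𝟙 (avoids? (a ∷ as) x)) + 1 + length as
    ≡⟨ cong (λ s → ∑ᶻ m (λ x → 𝟙 (avoids? (a ∷ as) x)) + s + length as) (∑ᶻ-𝟙≈ m a) ⟨
  ∑ᶻ m (λ x → 𝟙 (avoids? (a ∷ as) x)) + ∑ᶻ m (λ x → 𝟙 (x ≈? a [ m ])) + length as
    ≡⟨ cong (_+ length as) (∑-+ m _ _) ⟨
  ∑ᶻ m (λ x → 𝟙 (avoids? (a ∷ as) x) + 𝟙 (x ≈? a [ m ])) + length as
    ≡⟨ cong (_+ length as) (∑ᶻ-cong m split) ⟩
  ∑ᶻ m (λ x → 𝟙 (avoids? as x)) + length as
    ≡⟨ ∑ᶻ-avoiding m as≉ ⟩
  m ∎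
  where
  open ≡-Reasoning
  avoids? : ∀ bs x → Dec (All (λ b → ¬ x ≈ b [ m ]) bs)
  avoids? bs x = all? (λ b → ¬? (x ≈? b [ m ])) bs
  split′ : ∀ x (x≈a? : Dec (x ≈ a [ m ])) → 𝟙 (avoids? (a ∷ as) x) + 𝟙 x≈a? ≡ 𝟙 (avoids? as x)
  split′ x (yes x≈a) = trans
    (cong (_+ 1) (𝟙-no (avoids? (a ∷ as) x) λ { (x≉a ∷ _) → x≉a x≈a }))
    (sym (𝟙-yes (avoids? as x) (All.map (λ a≉b x≈b → a≉b (≈-trans (≈-sym x≈a) x≈b)) a≉as)))
  split′ x (no x≉a) = trans (+-identityʳ _)
    (𝟙-⇔ (avoids? (a ∷ as) x) (avoids? as x) All.tail (x≉a ∷_))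
  split : ∀ x → 𝟙 (avoids? (a ∷ as) x) + 𝟙 (x ≈? a [ m ]) ≡ 𝟙 (avoids? as x)
  split x = split′ x (x ≈? a [ m ])

-- Coprimality and inverses.

-- A common divisor d is coprime to p, for otherwise p would divide d and hence m. The factors p can
-- then be stripped from `p ^ k` one at a time.
∤⇒coprime-^ : ∀ {p m} → Prime p → ¬ p ℕ∣.∣ m → ∀ k → Coprime m (p ^ k)
∤⇒coprime-^ pp p∤m zero    (_ , d∣1) = ℕ∣.∣1⇒≡1 d∣1
∤⇒coprime-^ {p} pp p∤m (suc k) {d} (d∣m , d∣p*p^k) =
  ∤⇒coprime-^ pp p∤m k (d∣m , coprime-divisor d-coprime-p d∣p*p^k)
  where
  d-coprime-p : Coprime d p
  d-coprime-p (e∣d , e∣p) with prime⇒irreducible pp e∣p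
  ... | inj₁ e≡1  = e≡1
  ... | inj₂ refl = contradiction (ℕ∣.∣-trans e∣d d∣m) p∤m

abstract

  -- Bézout over ℕ comes with either sign: from 1 + y n = x m the inverse is x, from 1 + x m = y n
  -- it is -x.
  coprime⇒inverse : ∀ {m n} → Coprime m n → ∃ λ b → + m ℤ.* b ≈ + 1 [ n ]
  coprime⇒inverse {m} {n} m⊥n with coprime-Bézout m⊥n
  ... | Bézout.+- x y 1+yn≡xm = + x , mk≈ (divides (+ y) (begin
    + m ℤ.* + x ℤ.- + 1              ≡⟨ cong (ℤ._- + 1) (ℤ.pos-* m x) ⟨
    + (m * x) ℤ.- + 1                ≡⟨ cong (λ k → + k ℤ.- + 1) (trans (*-comm m x) (sym 1+yn≡xm)) ⟩
    + (1 + y * n) ℤ.- + 1            ≡⟨ cong (ℤ._- + 1) (trans (ℤ.pos-+ 1 (y * n)) (cong (λ k → + 1 ℤ.+ k) (ℤ.pos-* y n))) ⟩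
    + 1 ℤ.+ + y ℤ.* + n ℤ.- + 1      ≡⟨ identity (+ y ℤ.* + n) ⟩
    + y ℤ.* + n                      ∎))
    where
    open ≡-Reasoning
    identity : ∀ a → + 1 ℤ.+ a ℤ.- + 1 ≡ a
    identity = ℤ-Solver.solve-∀
  ... | Bézout.-+ x y 1+xm≡yn = ℤ.- + x , mk≈ (divides (ℤ.- + y) (begin
    + m ℤ.* ℤ.- + x ℤ.- + 1          ≡⟨ identity (+ m) (+ x) ⟩
    ℤ.- (+ 1 ℤ.+ + x ℤ.* + m)        ≡⟨ cong ℤ.-_ (trans (ℤ.pos-+ 1 (x * m)) (cong (λ k → + 1 ℤ.+ k) (ℤ.pos-* x m))) ⟨
    ℤ.- + (1 + x * m)                ≡⟨ cong (λ k → ℤ.- + k) 1+xm≡yn ⟩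
    ℤ.- + (y * n)                    ≡⟨ cong ℤ.-_ (ℤ.pos-* y n) ⟩
    ℤ.- (+ y ℤ.* + n)                ≡⟨ ℤ.neg-distribˡ-* (+ y) (+ n) ⟩
    ℤ.- + y ℤ.* + n                  ∎))
    where
    open ≡-Reasoning
    identity : ∀ a b → a ℤ.* ℤ.- b ℤ.- + 1 ≡ ℤ.- (+ 1 ℤ.+ b ℤ.* a)
    identity = ℤ-Solver.solve-∀

-- Units modulo a prime power.

module PrimePower (p : ℕ) (pp : Prime p) (p%4≡1 : p % 4 ≡ 1) (β : ℕ) where

  n : ℕ
  n = p ^ suc β

  instance
    p≢0 : NonZero p
    p≢0 = prime⇒nonZero pp
    n≢0 : NonZero n
    n≢0 = m^n≢0 p (suc β)

  5≤p : 5 ≤ p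
  5≤p = bound p pp p%4≡1
    where
    bound : ∀ q → Prime q → q % 4 ≡ 1 → 5 ≤ q
    bound 0 _  ()
    bound 1 q-prime _ = contradiction q-prime ¬prime[1]
    bound 2 _  ()
    bound 3 _  ()
    bound 4 _  ()
    bound (suc (suc (suc (suc (suc q))))) _ _ = s≤s (s≤s (s≤s (s≤s (s≤s z≤n))))

  p∣n : + p ∣ + n
  p∣n = ∣ᵤ⇒∣ (ℕ∣.m∣m*n (p ^ β))

  mod-p : ∀ {a b} → a ≈ b [ n ] → a ≈ b [ p ]
  mod-p = ≈-divisor p∣n

  -- Modulo the prime power n, the units are the residues not divisible by p.
  Unit : ℤ → Set
  Unit x = ¬ + p ∣ x

  abstract

    unit? : ∀ x → Dec (Unit x)
    unit? x = ¬? (+ p ∣? x)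

  Unit-resp-p : ∀ {a b} → a ≈ b [ p ] → Unit a → Unit b
  Unit-resp-p {a} {b} (mk≈ p∣a-b) ua p∣b = ua (∣-combination (+ 1) (+ 1) p∣a-b p∣b (identity a b))
    where identity : ∀ a b → a ≡ + 1 ℤ.* (a ℤ.- b) ℤ.+ + 1 ℤ.* b
          identity = ℤ-Solver.solve-∀

  Unit-resp : ∀ {a b} → a ≈ b [ n ] → Unit a → Unit b
  Unit-resp = Unit-resp-p ∘ mod-p

  p∣ab⇒p∣a⊎p∣b : ∀ a b → + p ∣ a ℤ.* b → + p ∣ a ⊎ + p ∣ b
  p∣ab⇒p∣a⊎p∣b a b p∣ab with euclidsLemma ℤ.∣ a ∣ ℤ.∣ b ∣ pp (subst (p ℕ∣.∣_) (ℤ.abs-* a b) (∣⇒∣ᵤ p∣ab))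
  ... | inj₁ p∣a = inj₁ (∣ᵤ⇒∣ p∣a)
  ... | inj₂ p∣b = inj₂ (∣ᵤ⇒∣ p∣b)

  Unit-* : ∀ {a b} → Unit a → Unit b → Unit (a ℤ.* b)
  Unit-* {a} {b} ua ub p∣ab with p∣ab⇒p∣a⊎p∣b a b p∣ab
  ... | inj₁ p∣a = ua p∣a
  ... | inj₂ p∣b = ub p∣b

  Unit-*⁻ʳ : ∀ a {b} → Unit (a ℤ.* b) → Unit b
  Unit-*⁻ʳ a uab p∣b = uab (∣n⇒∣m*n a p∣b)

  Unit-small : ∀ {m} .{{_ : NonZero m}} → m < 5 → Unit (+ m)
  Unit-small m<5 p∣m = ℕ∣.>⇒∤ (<-≤-trans m<5 5≤p) (∣⇒∣ᵤ p∣m)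

  Unit-1 : Unit (+ 1)
  Unit-1 = Unit-small (s≤s (s≤s z≤n))

  Unit-2 : Unit (+ 2)
  Unit-2 = Unit-small (s≤s (s≤s (s≤s z≤n)))

  ¬Unit-0 : ¬ Unit (+ 0)
  ¬Unit-0 u0 = u0 (divides (+ 0) refl)

  Unit-neg : ∀ {x} → Unit x → Unit (ℤ.- x)
  Unit-neg {x} ux p∣-x = ux (∣-multiple (ℤ.- + 1) p∣-x (identity x))
    where identity : ∀ x → x ≡ ℤ.- + 1 ℤ.* ℤ.- x
          identity = ℤ-Solver.solve-∀

  coprime⇒Unit : ∀ {x} → Coprime x n → Unit (+ x)
  coprime⇒Unit x⊥n p∣x = ¬prime[1] (subst Prime (x⊥n (∣⇒∣ᵤ p∣x , ∣⇒∣ᵤ p∣n)) pp)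

  Unit⇒coprime : ∀ {x} → Unit (+ x) → Coprime x n
  Unit⇒coprime ux = ∤⇒coprime-^ pp (ux ∘ ∣ᵤ⇒∣) (suc β)

  inverse : ∀ {a} → Unit a → ∃ λ b → a ℤ.* b ≈ + 1 [ n ]
  inverse {a} ua =
    let b , rb≈1 = coprime⇒inverse (Unit⇒coprime (Unit-resp (≈-sym (%ℕ-≈ a n)) ua))
    in  b , ≈-trans (*-cong-≈ (≈-sym (%ℕ-≈ a n)) ≈-refl) rb≈1

  cancelˡ : ∀ {a x} → Unit a → + n ∣ a ℤ.* x → + n ∣ x
  cancelˡ {a} {x} ua n∣ax =
    let b , ab≈1 = inverse ua
    in  ∣-combination b (ℤ.- x) n∣ax (n∣a-b ab≈1) (identity a b x)
    where identity : ∀ a b x → x ≡ b ℤ.* (a ℤ.* x) ℤ.+ ℤ.- x ℤ.* (a ℤ.* b ℤ.- + 1)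
          identity = ℤ-Solver.solve-∀

  *-cancelˡ-≈ : ∀ {a x y} → Unit a → a ℤ.* x ≈ a ℤ.* y [ n ] → x ≈ y [ n ]
  *-cancelˡ-≈ {a} {x} {y} ua (mk≈ n∣) = mk≈ (cancelˡ ua (subst (+ n ∣_) (identity a x y) n∣))
    where identity : ∀ a x y → a ℤ.* x ℤ.- a ℤ.* y ≡ a ℤ.* (x ℤ.- y)
          identity = ℤ-Solver.solve-∀

  -- p cannot divide both factors of (x - y)(x + y), since it would divide 2y.
  square-roots : ∀ {x y} → Unit y → x ℤ.* x ≈ y ℤ.* y [ n ] → x ≈ y [ n ] ⊎ x ≈ ℤ.- y [ n ]
  square-roots {x} {y} uy (mk≈ n∣x²-y²) with unit? (x ℤ.- y)
  ... | yes u- = inj₂ (mk≈ (subst (+ n ∣_) (negate x y) (cancelˡ u- (subst (+ n ∣_) (factor x y) n∣x²-y²))))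
    where
    negate : ∀ x y → x ℤ.+ y ≡ x ℤ.- ℤ.- y
    negate = ℤ-Solver.solve-∀
    factor : ∀ x y → x ℤ.* x ℤ.- y ℤ.* y ≡ (x ℤ.- y) ℤ.* (x ℤ.+ y)
    factor = ℤ-Solver.solve-∀
  ... | no ¬u- = inj₁ (mk≈ (cancelˡ u+ (subst (+ n ∣_) (factor x y) n∣x²-y²)))
    where
    factor : ∀ x y → x ℤ.* x ℤ.- y ℤ.* y ≡ (x ℤ.+ y) ℤ.* (x ℤ.- y)
    factor = ℤ-Solver.solve-∀
    identity : ∀ x y → + 2 ℤ.* y ≡ + 1 ℤ.* (x ℤ.+ y) ℤ.+ ℤ.- + 1 ℤ.* (x ℤ.- y)
    identity = ℤ-Solver.solve-∀
    u+ : Unit (x ℤ.+ y)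
    u+ p∣x+y = ¬u- λ p∣x-y → Unit-* Unit-2 uy (∣-combination (+ 1) (ℤ.- + 1) p∣x+y p∣x-y (identity x y))

  -- The difference is 2x, and p is odd. Holding already modulo p, this separates the two roots of a
  -- square as well as the opposite pairs ± 1 and ± i.
  Unit⇒≉- : ∀ {x} → Unit x → ¬ x ≈ ℤ.- x [ p ]
  Unit⇒≉- {x} ux (mk≈ p∣) = Unit-* Unit-2 ux (∣-multiple (+ 1) p∣ (identity x))
    where identity : ∀ x → + 2 ℤ.* x ≡ + 1 ℤ.* (x ℤ.- ℤ.- x)
          identity = ℤ-Solver.solve-∀

  -- Squares of units and adjacency.

  Square : ℤ → Set
  Square d = ∃ λ x → Unit x × x ℤ.* x ≈ d [ n ]

  Square-resp : ∀ {a b} → a ≈ b [ n ] → Square a → Square b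
  Square-resp a≈b (x , ux , x²≈a) = x , ux , ≈-trans x²≈a a≈b

  Square⇒Unit : ∀ {d} → Square d → Unit d
  Square⇒Unit (x , ux , x²≈d) = Unit-resp x²≈d (Unit-* ux ux)

  Square-* : ∀ {a b} → Square a → Square b → Square (a ℤ.* b)
  Square-* {a} {b} (x , ux , x²≈a) (y , uy , y²≈b) =
    x ℤ.* y , Unit-* ux uy , ≈-trans (≈-reflexive (identity x y)) (*-cong-≈ x²≈a y²≈b)
    where identity : ∀ x y → x ℤ.* y ℤ.* (x ℤ.* y) ≡ x ℤ.* x ℤ.* (y ℤ.* y)
          identity = ℤ-Solver.solve-∀

  -- If x² ≡ d, then x e is a root of e, because (x e)² ≡ (d e) e ≡ e.
  Square-reciprocal : ∀ {d e} → Square d → d ℤ.* e ≈ + 1 [ n ] → Square e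
  Square-reciprocal {d} {e} (x , ux , x²≈d) de≈1 = x ℤ.* e , Unit-* ux ue ,
    ≈-trans (≈-reflexive (identity x e)) (≈-trans (*-cong-≈ (*-cong-≈ x²≈d ≈-refl) ≈-refl)
      (≈-trans (*-cong-≈ de≈1 ≈-refl) (≈-reflexive (ℤ.*-identityˡ e))))
    where
    identity : ∀ x e → x ℤ.* e ℤ.* (x ℤ.* e) ≡ x ℤ.* x ℤ.* e ℤ.* e
    identity = ℤ-Solver.solve-∀
    ue : Unit e
    ue = Unit-*⁻ʳ d (Unit-resp (≈-sym de≈1) Unit-1)

  IsUnitSquare⇒Square : ∀ {d} → IsUnitSquare n d → Square (+ d)
  IsUnitSquare⇒Square {d} sq with satisfied sq
  ... | x , x⊥n , x²%n≡d%n = + x , coprime⇒Unit x⊥n ,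
    ≈-trans (≈-reflexive (sym (ℤ.pos-* x x))) (%≡⇒≈ (x * x) d n x²%n≡d%n)

  Square⇒IsUnitSquare : ∀ {d} → Square (+ d) → IsUnitSquare n d
  Square⇒IsUnitSquare {d} (x , ux , x²≈d) = lose (∈-upTo⁺ (ℤ.n%ℕd<d x n))
    (Unit⇒coprime (Unit-resp (≈-sym r≈x) ux) , ≈⇒%≡ (r * r) d n
      (≈-trans (≈-reflexive (ℤ.pos-* r r)) (≈-trans (*-cong-≈ r≈x r≈x) x²≈d)))
    where
    r = x ℤ.%ℕ n
    r≈x : + r ≈ x [ n ]
    r≈x = %ℕ-≈ x n

  abstract

    square? : ∀ d → Dec (Square d)
    square? d = map′ (Square-resp (%ℕ-≈ d n) ∘ IsUnitSquare⇒Square)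
                     (Square⇒IsUnitSquare ∘ Square-resp (≈-sym (%ℕ-≈ d n)))
                     (isUnitSquare? n (d ℤ.%ℕ n))

  diffMod-≈ : ∀ a {b} → b < n → + diffMod n a b ≈ + a ℤ.- + b [ n ]
  diffMod-≈ a {b} b<n = ≈-trans (%ℕ-≈ (+ (a + (n ∸ b))) n) (mk≈ (divides (+ 1) (begin
    + (a + (n ∸ b)) ℤ.- (+ a ℤ.- + b)          ≡⟨ cong (ℤ._- (+ a ℤ.- + b)) (ℤ.pos-+ a (n ∸ b)) ⟩
    + a ℤ.+ + (n ∸ b) ℤ.- (+ a ℤ.- + b)        ≡⟨ cong (λ k → + a ℤ.+ k ℤ.- (+ a ℤ.- + b)) (trans (sym (ℤ.⊖-≥ (<⇒≤ b<n))) (sym (ℤ.m-n≡m⊖n n b))) ⟩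
    + a ℤ.+ (+ n ℤ.- + b) ℤ.- (+ a ℤ.- + b)    ≡⟨ identity (+ a) (+ b) (+ n) ⟩
    + 1 ℤ.* + n                                ∎)))
    where
    open ≡-Reasoning
    identity : ∀ a b n → a ℤ.+ (n ℤ.- b) ℤ.- (a ℤ.- b) ≡ + 1 ℤ.* n
    identity = ℤ-Solver.solve-∀

  Adj⇒Square : ∀ {a b} → b < n → Adj n a b → Square (+ a ℤ.- + b)
  Adj⇒Square {a} b<n (_ , sq) = Square-resp (diffMod-≈ a b<n) (IsUnitSquare⇒Square sq)

  Square⇒Adj : ∀ {a b} → b < n → Square (+ a ℤ.- + b) → Adj n a b
  Square⇒Adj {a} b<n sq =
    -- Distinctness comes for free: a square of a unit is a unit, and a - a = 0 is not.
    (λ { refl → ¬Unit-0 (subst Unit (ℤ.+-inverseʳ (+ a)) (Square⇒Unit sq)) }) ,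
    Square⇒IsUnitSquare (Square-resp (≈-sym (diffMod-≈ a b<n)) sq)

  -- Weighted sums over units and over squares.

  υ χ : ℤ → ℕ
  υ x = 𝟙 (unit? x)
  χ d = 𝟙 (square? d)

  υ-periodic-p : Periodic p υ
  υ-periodic-p = 𝟙-periodic unit? Unit-resp-p

  υ-periodic : Periodic n υ
  υ-periodic = υ-periodic-p ∘ mod-p

  χ-periodic : Periodic n χ
  χ-periodic = 𝟙-periodic square? Square-resp

  -- A square of a unit has exactly the two roots ± x.
  ∑-roots : ∀ d → ∑ᶻ n (λ x → υ x * 𝟙 (d ≈? x ℤ.* x [ n ])) ≡ 2 * χ d
  ∑-roots d = count (square? d)
    where
    count : (sq? : Dec (Square d)) → ∑ᶻ n (λ x → υ x * 𝟙 (d ≈? x ℤ.* x [ n ])) ≡ 2 * 𝟙 sq?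
    count (no ¬sq) = ∑-zero n λ i → trans
      (𝟙-*-cong (unit? (+ i)) λ ui → 𝟙-no (d ≈? + i ℤ.* + i [ n ]) λ d≈i² → ¬sq (+ i , ui , ≈-sym d≈i²))
      (*-zeroʳ (υ (+ i)))
    count (yes (r , ur , r²≈d)) = begin
      ∑ᶻ n (λ x → υ x * 𝟙 (d ≈? x ℤ.* x [ n ]))
        ≡⟨ ∑-cong n (λ i → term (+ i) (+ i ≈? r [ n ]) (+ i ≈? ℤ.- r [ n ])) ⟩
      ∑ᶻ n (λ x → 𝟙 (x ≈? r [ n ]) + 𝟙 (x ≈? ℤ.- r [ n ]))
        ≡⟨ ∑-+ n _ _ ⟩
      ∑ᶻ n (λ x → 𝟙 (x ≈? r [ n ])) + ∑ᶻ n (λ x → 𝟙 (x ≈? ℤ.- r [ n ]))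
        ≡⟨ cong₂ _+_ (∑ᶻ-𝟙≈ n r) (∑ᶻ-𝟙≈ n (ℤ.- r)) ⟩
      2 ∎
      where
      open ≡-Reasoning
      root : ∀ x → Unit x → d ≈ x ℤ.* x [ n ] → υ x * 𝟙 (d ≈? x ℤ.* x [ n ]) ≡ 1
      root x ux d≈x² = cong₂ _*_ (𝟙-yes (unit? x) ux) (𝟙-yes (d ≈? x ℤ.* x [ n ]) d≈x²)
      term : ∀ x (x≈r? : Dec (x ≈ r [ n ])) (x≈-r? : Dec (x ≈ ℤ.- r [ n ])) →
             υ x * 𝟙 (d ≈? x ℤ.* x [ n ]) ≡ 𝟙 x≈r? + 𝟙 x≈-r?
      term x (yes x≈r) (yes x≈-r) = contradiction (mod-p (≈-trans (≈-sym x≈r) x≈-r)) (Unit⇒≉- ur)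
      term x (yes x≈r) (no _) = root x (Unit-resp (≈-sym x≈r) ur)
        (≈-trans (≈-sym r²≈d) (≈-sym (*-cong-≈ x≈r x≈r)))
      term x (no _) (yes x≈-r) = root x (Unit-resp (≈-sym x≈-r) (Unit-neg ur))
        (≈-trans (≈-sym r²≈d) (≈-sym (≈-trans (*-cong-≈ x≈-r x≈-r) (≈-reflexive (neg-square r)))))
      term x (no x≉r) (no x≉-r) = trans
        (cong (υ x *_) (𝟙-no (d ≈? x ℤ.* x [ n ]) λ d≈x² → not-root (square-roots ur (≈-sym (≈-trans r²≈d d≈x²)))))
        (*-zeroʳ (υ x))
        where not-root : ¬ (x ≈ r [ n ] ⊎ x ≈ ℤ.- r [ n ])
              not-root (inj₁ x≈r)  = x≉r x≈r
              not-root (inj₂ x≈-r) = x≉-r x≈-r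

  -- This is the change of variables d = x². Pairs (d, x) with x a unit and x² ≡ d are counted in
  -- both orders: a fixed d has 2 χ(d) roots, a fixed x determines d.
  ∑-squares : ∀ {G} → Periodic n G → ∑ᶻ n (λ d → 2 * χ d * G d) ≡ ∑ᶻ n (λ x → υ x * G (x ℤ.* x))
  ∑-squares {G} G-per = begin
    ∑ᶻ n (λ d → 2 * χ d * G d)
      ≡⟨ ∑ᶻ-cong n (λ d → cong (_* G d) (∑-roots d)) ⟨
    ∑ᶻ n (λ d → ∑ᶻ n (λ x → υ x * 𝟙 (d ≈? x ℤ.* x [ n ])) * G d)
      ≡⟨ ∑-cong n (λ i → ∑-*ʳ n (G (+ i)) _) ⟨
    ∑ᶻ n (λ d → ∑ᶻ n (λ x → υ x * 𝟙 (d ≈? x ℤ.* x [ n ]) * G d))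
      ≡⟨ ∑-swap n n _ ⟩
    ∑ᶻ n (λ x → ∑ᶻ n (λ d → υ x * 𝟙 (d ≈? x ℤ.* x [ n ]) * G d))
      ≡⟨ ∑-cong n (λ i → fibre (+ i)) ⟩
    ∑ᶻ n (λ x → υ x * G (x ℤ.* x)) ∎
    where
    open ≡-Reasoning
    fibre : ∀ x → ∑ᶻ n (λ d → υ x * 𝟙 (d ≈? x ℤ.* x [ n ]) * G d) ≡ υ x * G (x ℤ.* x)
    fibre x = begin
      ∑ᶻ n (λ d → υ x * 𝟙 (d ≈? x ℤ.* x [ n ]) * G d)
        ≡⟨ ∑-cong n (λ i → *-assoc (υ x) _ _) ⟩
      ∑ᶻ n (λ d → υ x * (𝟙 (d ≈? x ℤ.* x [ n ]) * G d))
        ≡⟨ ∑-*ˡ n (υ x) _ ⟩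
      υ x * ∑ᶻ n (λ d → 𝟙 (d ≈? x ℤ.* x [ n ]) * G d)
        ≡⟨ cong (υ x *_) (∑ᶻ-δ n G-per (x ℤ.* x)) ⟩
      υ x * G (x ℤ.* x) ∎

  ∑-periodic-p : ∀ {F} → Periodic p F → ∑ᶻ n F ≡ p ^ β * ∑ᶻ p F
  ∑-periodic-p {F} F-per = trans (cong (λ m → ∑ᶻ m F) (*-comm p (p ^ β))) (∑ᶻ-periods p (p ^ β) F-per)

  -- A condition that depends only on the residue modulo p is counted modulo p, and every residue
  -- there has `p ^ β` lifts.
  ∑-avoiding : ∀ {P : ℤ → Set} (P? : ∀ x → Dec (P x)) → Periodic p (λ x → 𝟙 (P? x)) →
    ∀ {as} → AllPairs (λ a b → ¬ a ≈ b [ p ]) as →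
    (∀ x → P x → All (λ a → ¬ x ≈ a [ p ]) as) → (∀ x → All (λ a → ¬ x ≈ a [ p ]) as → P x) →
    ∑ᶻ n (λ x → 𝟙 (P? x)) ≡ p ^ β * (p ∸ length as)
  ∑-avoiding P? P-per {as} as≉ to from = trans (∑-periodic-p P-per) (cong (p ^ β *_) (begin
    ∑ᶻ p (λ x → 𝟙 (P? x))
      ≡⟨ m+n∸n≡m _ (length as) ⟨
    ∑ᶻ p (λ x → 𝟙 (P? x)) + length as ∸ length as
      ≡⟨ cong (λ s → s + length as ∸ length as) (∑-cong p λ i → 𝟙-⇔ (P? (+ i)) (avoids? (+ i)) (to (+ i)) (from (+ i))) ⟩
    ∑ᶻ p (λ x → 𝟙 (avoids? x)) + length as ∸ length as
      ≡⟨ cong (_∸ length as) (∑ᶻ-avoiding p as≉) ⟩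
    p ∸ length as ∎))
    where
    open ≡-Reasoning
    avoids? : ∀ x → Dec (All (λ a → ¬ x ≈ a [ p ]) as)
    avoids? x = all? (λ a → ¬? (x ≈? a [ p ])) as

  -- The value is Euler's φ(n): the only class to avoid modulo p is 0.
  ∑-υ : ∑ᶻ n υ ≡ p ^ β * (p ∸ 1)
  ∑-υ = ∑-avoiding unit? υ-periodic-p {+ 0 ∷ []} ([] ∷ [])
    (λ x ux → (λ x≈0 → ux (subst (+ p ∣_) (x-0≡x x) (n∣a-b x≈0))) ∷ [])
    (λ { x (x≉0 ∷ []) p∣x → x≉0 (mk≈ (subst (+ p ∣_) (sym (x-0≡x x)) p∣x)) })
    where x-0≡x : ∀ x → x ℤ.- + 0 ≡ x
          x-0≡x = ℤ-Solver.solve-∀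

  -- Minus one is a square.

  p∸1≡[p/4]*4 : p ∸ 1 ≡ p / 4 * 4
  p∸1≡[p/4]*4 = cong (_∸ 1) (trans (m≡m%n+[m/n]*n p 4) (cong (_+ p / 4 * 4) p%4≡1))

  -- The number p^β (p - 1) / 2 of squares is even; if -1 were not a square, then
  -- inversion would be an involution of the squares with the single fixed point 1.
  Square--1 : Square (ℤ.- + 1)
  Square--1 = decidable-stable (square? (ℤ.- + 1)) λ ¬sq → even≢odd (p ^ β * (p / 4)) below (even≡odd ¬sq)
    where
    open ≡-Reasoning
    -- The graph of inversion on the squares, as a symmetric 0-1 matrix. Every square has one
    -- inverse, so the total is the number of squares; it has the parity of the diagonal, where the
    -- fixed points lie.
    f : ℕ → ℕ → ℕ
    f i j = χ (+ j) * 𝟙 (+ j ℤ.* + i ≈? + 1 [ n ])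
    f≡𝟙 : ∀ i j → f i j ≡ 𝟙 (square? (+ j) ×-dec + j ℤ.* + i ≈? + 1 [ n ])
    f≡𝟙 i j = sym (𝟙-× (square? (+ j)) (+ j ℤ.* + i ≈? + 1 [ n ]))
    swap : ∀ i j → Square (+ j) × + j ℤ.* + i ≈ + 1 [ n ] → Square (+ i) × + i ℤ.* + j ≈ + 1 [ n ]
    swap i j (sq , ji≈1) = Square-reciprocal sq ji≈1 , ≈-trans (≈-reflexive (ℤ.*-comm (+ i) (+ j))) ji≈1
    f-sym : ∀ i j → f i j ≡ f j i
    f-sym i j = trans (f≡𝟙 i j) (trans (𝟙-⇔ (square? (+ j) ×-dec + j ℤ.* + i ≈? + 1 [ n ])
      (square? (+ i) ×-dec + i ℤ.* + j ≈? + 1 [ n ]) (swap i j) (swap j i)) (sym (f≡𝟙 j i)))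
    row : ∀ j → ∑ n (λ i → f i j) ≡ χ (+ j)
    row j = begin
      ∑ n (λ i → f i j)                                                   ≡⟨ ∑-*ˡ n (χ (+ j)) _ ⟩
      χ (+ j) * ∑ n (λ i → 𝟙 (+ j ℤ.* + i ≈? + 1 [ n ]))                  ≡⟨ 𝟙-*-cong (square? (+ j)) reciprocals ⟩
      χ (+ j) * 1                                                         ≡⟨ *-identityʳ (χ (+ j)) ⟩
      χ (+ j)                                                             ∎
      where
      reciprocals : Square (+ j) → ∑ n (λ i → 𝟙 (+ j ℤ.* + i ≈? + 1 [ n ])) ≡ 1
      reciprocals sq =
        let uj = Square⇒Unit sq
            b , jb≈1 = inverse uj
        in  trans (∑-cong n λ i → 𝟙-⇔ (+ j ℤ.* + i ≈? + 1 [ n ]) (+ i ≈? b [ n ])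
              (λ ji≈1 → *-cancelˡ-≈ {+ j} uj (≈-trans ji≈1 (≈-sym jb≈1)))
              (λ i≈b → ≈-trans (*-cong-≈ {a = + j} ≈-refl i≈b) jb≈1))
              (∑ᶻ-𝟙≈ n b)
    fixed : ¬ Square (ℤ.- + 1) → ∀ i → f i i ≡ 𝟙 (+ i ≈? + 1 [ n ])
    fixed ¬sq i = trans (f≡𝟙 i i) (𝟙-⇔ (square? (+ i) ×-dec + i ℤ.* + i ≈? + 1 [ n ]) (+ i ≈? + 1 [ n ]) to from)
      where
      to : Square (+ i) × + i ℤ.* + i ≈ + 1 [ n ] → + i ≈ + 1 [ n ]
      to (sq , i²≈1) with square-roots Unit-1 i²≈1
      ... | inj₁ i≈1  = i≈1
      ... | inj₂ i≈-1 = contradiction (Square-resp i≈-1 sq) ¬sq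
      from : + i ≈ + 1 [ n ] → Square (+ i) × + i ℤ.* + i ≈ + 1 [ n ]
      from i≈1 = (+ 1 , Unit-1 , ≈-sym i≈1) , *-cong-≈ i≈1 i≈1
    below = ∑ n (λ j → ∑ j (λ i → f i j))
    rearrange : ∀ a b → 2 * (2 * (a * b)) ≡ a * (b * 4)
    rearrange = ℕ-Solver.solve-∀
    ∑χ : 2 * ∑ᶻ n χ ≡ p ^ β * (p ∸ 1)
    ∑χ = begin
      2 * ∑ᶻ n χ                      ≡⟨ ∑-*ˡ n 2 _ ⟨
      ∑ᶻ n (λ d → 2 * χ d)            ≡⟨ ∑ᶻ-cong n (λ d → *-identityʳ (2 * χ d)) ⟨
      ∑ᶻ n (λ d → 2 * χ d * 1)        ≡⟨ ∑-squares {λ _ → 1} (λ _ → refl) ⟩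
      ∑ᶻ n (λ x → υ x * 1)            ≡⟨ ∑ᶻ-cong n (λ x → *-identityʳ (υ x)) ⟩
      ∑ᶻ n υ                          ≡⟨ ∑-υ ⟩
      p ^ β * (p ∸ 1)                 ∎
    even≡odd : ¬ Square (ℤ.- + 1) → 2 * (p ^ β * (p / 4)) ≡ suc (2 * below)
    even≡odd ¬sq = begin
      -- Twice the number of squares is `p ^ β * (p ∸ 1)`, and p - 1 = 4 (p / 4); cancelling one 2
      -- leaves an even number.
      2 * (p ^ β * (p / 4))                    ≡⟨ *-cancelˡ-≡ _ _ 2 (trans (rearrange (p ^ β) (p / 4)) (trans (cong (p ^ β *_) (sym p∸1≡[p/4]*4)) (sym ∑χ))) ⟩
      ∑ᶻ n χ                                   ≡⟨ ∑-cong n row ⟨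
      ∑ n (λ j → ∑ n (λ i → f i j))            ≡⟨ ∑-symmetric₂ n f f-sym ⟩
      2 * below + ∑ n (λ i → f i i)            ≡⟨ cong (λ s → 2 * below + s) (trans (∑-cong n (fixed ¬sq)) (∑ᶻ-𝟙≈ n (+ 1))) ⟩
      2 * below + 1                            ≡⟨ +-comm (2 * below) 1 ⟩
      suc (2 * below)                          ∎

  -- The conic x² - z² = 1 in units.

  Good : ℤ → Set
  Good w = Unit w × Unit (w ℤ.* w ℤ.+ + 1) × Unit (w ℤ.* w ℤ.- + 1)

  abstract

    good? : ∀ w → Dec (Good w)
    good? w = unit? w ×-dec (unit? (w ℤ.* w ℤ.+ + 1) ×-dec unit? (w ℤ.* w ℤ.- + 1))

  Good-resp : ∀ {a b} → a ≈ b [ p ] → Good a → Good b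
  Good-resp a≈b (ua , ua²+1 , ua²-1) =
    Unit-resp-p a≈b ua ,
    Unit-resp-p (+-cong-≈ (*-cong-≈ a≈b a≈b) ≈-refl) ua²+1 ,
    Unit-resp-p (minus-cong-≈ (*-cong-≈ a≈b a≈b) ≈-refl) ua²-1

  -- The five classes are distinct modulo p: 0 is not a unit, opposite units differ, and ± 1 differ
  -- from ± i because their squares 1 and -1 differ. Conversely, if p divides w² - a² with a = 1 or
  -- a = i, it divides w - a or w + a. The root i of -1 is taken modulo n and then reduced modulo p.
  ∑-good : ∑ᶻ n (λ w → 𝟙 (good? w)) ≡ p ^ β * (p ∸ 5)
  ∑-good = count Square--1
    where
    x-0≡x : ∀ x → x ℤ.- + 0 ≡ x
    x-0≡x = ℤ-Solver.solve-∀
    ≈0⇒∣ : ∀ {x} → x ≈ + 0 [ p ] → + p ∣ x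
    ≈0⇒∣ {x} (mk≈ p∣) = subst (+ p ∣_) (x-0≡x x) p∣
    0≉ : ∀ {x} → Unit x → ¬ + 0 ≈ x [ p ]
    0≉ ux 0≈x = ux (≈0⇒∣ (≈-sym 0≈x))
    count : Square (ℤ.- + 1) → ∑ᶻ n (λ w → 𝟙 (good? w)) ≡ p ^ β * (p ∸ 5)
    count (i , ui , i²≈-1) = ∑-avoiding good? (𝟙-periodic good? Good-resp)
      {+ 0 ∷ + 1 ∷ ℤ.- + 1 ∷ i ∷ ℤ.- i ∷ []}
      ((0≉ Unit-1 ∷ 0≉ (Unit-neg Unit-1) ∷ 0≉ ui ∷ 0≉ (Unit-neg ui) ∷ []) ∷
       (Unit⇒≉- Unit-1 ∷ (λ 1≈i → ±1≉±i refl refl 1≈i) ∷ (λ 1≈-i → ±1≉±i refl (neg-square i) 1≈-i) ∷ []) ∷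
       ((λ -1≈i → ±1≉±i refl refl -1≈i) ∷ (λ -1≈-i → ±1≉±i refl (neg-square i) -1≈-i) ∷ []) ∷
       (Unit⇒≉- ui ∷ []) ∷ [] ∷ [])
      to from
      where
      ±1≉±i : ∀ {a b} → a ℤ.* a ≡ + 1 → b ℤ.* b ≡ i ℤ.* i → ¬ a ≈ b [ p ]
      ±1≉±i a²≡1 b²≡i² a≈b = Unit⇒≉- Unit-1 (≈-trans (≈-reflexive (sym a²≡1))
        (≈-trans (*-cong-≈ a≈b a≈b) (≈-trans (≈-reflexive b²≡i²) (mod-p i²≈-1))))
      to : ∀ w → Good w → All (λ a → ¬ w ≈ a [ p ]) (+ 0 ∷ + 1 ∷ ℤ.- + 1 ∷ i ∷ ℤ.- i ∷ [])
      to w (uw , uw²+1 , uw²-1) =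
        (λ w≈0 → uw (≈0⇒∣ w≈0)) ∷ avoid-±1 refl ∷ avoid-±1 refl ∷ avoid-±i refl ∷ avoid-±i (neg-square i) ∷ []
        where
        avoid-±1 : ∀ {a} → a ℤ.* a ≡ + 1 → ¬ w ≈ a [ p ]
        avoid-±1 a²≡1 w≈a = uw²-1 (n∣a-b (≈-trans (*-cong-≈ w≈a w≈a) (≈-reflexive a²≡1)))
        avoid-±i : ∀ {a} → a ℤ.* a ≡ i ℤ.* i → ¬ w ≈ a [ p ]
        avoid-±i a²≡i² w≈a = uw²+1 (n∣a-b {b = ℤ.- + 1}
          (≈-trans (*-cong-≈ w≈a w≈a) (≈-trans (≈-reflexive a²≡i²) (mod-p i²≈-1))))
      from : ∀ w → All (λ a → ¬ w ≈ a [ p ]) (+ 0 ∷ + 1 ∷ ℤ.- + 1 ∷ i ∷ ℤ.- i ∷ []) → Good w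
      from w (w≉0 ∷ w≉1 ∷ w≉-1 ∷ w≉i ∷ w≉-i ∷ []) =
        (λ p∣w → w≉0 (mk≈ (subst (+ p ∣_) (sym (x-0≡x w)) p∣w))) ,
        (λ p∣w²+1 → factor w≉i w≉-i (≈-trans (mk≈ {b = ℤ.- + 1} p∣w²+1) (≈-sym (mod-p i²≈-1)))) ,
        (λ p∣w²-1 → factor w≉1 w≉-1 (mk≈ p∣w²-1))
        where
        identity : ∀ w a → w ℤ.* w ℤ.- a ℤ.* a ≡ (w ℤ.- a) ℤ.* (w ℤ.- ℤ.- a)
        identity = ℤ-Solver.solve-∀
        factor : ∀ {a} → ¬ w ≈ a [ p ] → ¬ w ≈ ℤ.- a [ p ] → ¬ w ℤ.* w ≈ a ℤ.* a [ p ]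
        factor {a} w≉a w≉-a (mk≈ p∣w²-a²) =
          Unit-* (w≉a ∘ mk≈) (w≉-a ∘ mk≈) (subst (+ p ∣_) (identity w a) p∣w²-a²)

  solution : ℤ → ℤ → ℕ
  solution x z = υ x * (υ z * 𝟙 (x ℤ.* x ℤ.- + 1 ≈? z ℤ.* z [ n ]))

  solution-periodicˡ : ∀ z → Periodic n (λ x → solution x z)
  solution-periodicˡ z {a} {b} a≈b = cong₂ (λ s t → s * (υ z * t)) (υ-periodic a≈b)
    (𝟙-periodic (λ x → x ℤ.* x ℤ.- + 1 ≈? z ℤ.* z [ n ])
      (λ a≈b → ≈-trans (≈-sym (minus-cong-≈ (*-cong-≈ a≈b a≈b) ≈-refl))) a≈b)

  -- With w = x + z the equation x² - 1 = z² becomes 2wz = w² - 1, and then 2wx = w² + 1.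
  ∑-solutions : ∑ᶻ n (λ x → ∑ᶻ n (solution x)) ≡ p ^ β * (p ∸ 5)
  ∑-solutions = begin
    ∑ᶻ n (λ x → ∑ᶻ n (solution x))
      ≡⟨ ∑ᶻ-swap n n solution ⟩
    ∑ᶻ n (λ z → ∑ᶻ n (λ x → solution x z))
      ≡⟨ ∑-cong n (λ k → translate (+ k)) ⟨
    ∑ᶻ n (λ z → ∑ᶻ n (λ w → solution (w ℤ.- z) z))
      ≡⟨ ∑ᶻ-swap n n (λ z w → solution (w ℤ.- z) z) ⟩
    ∑ᶻ n (λ w → ∑ᶻ n (λ z → solution (w ℤ.- z) z))
      ≡⟨ ∑-cong n (λ k → fibre (+ k) (unit? (+ k))) ⟩
    ∑ᶻ n (λ w → 𝟙 (good? w))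
      ≡⟨ ∑-good ⟩
    p ^ β * (p ∸ 5) ∎
    where
    open ≡-Reasoning
    translate : ∀ z → ∑ᶻ n (λ w → solution (w ℤ.- z) z) ≡ ∑ᶻ n (λ x → solution x z)
    translate z = ∑ᶻ-permute n (ℤ._- z) (ℤ._+ z)
      (λ {x} {y} y≈x-z → ≈-sym (≈-trans (+-cong-≈ y≈x-z ≈-refl) (≈-reflexive (cancel x z))))
      (λ {x} {y} x≈y+z → ≈-sym (≈-trans (minus-cong-≈ x≈y+z ≈-refl) (≈-reflexive (cancel′ y z))))
      (solution-periodicˡ z)
      where
      cancel : ∀ x z → x ℤ.- z ℤ.+ z ≡ x
      cancel = ℤ-Solver.solve-∀
      cancel′ : ∀ x z → x ℤ.+ z ℤ.- z ≡ x
      cancel′ = ℤ-Solver.solve-∀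
    linear : ∀ w z → (w ℤ.- z) ℤ.* (w ℤ.- z) ℤ.- + 1 ≈ z ℤ.* z [ n ] → + 2 ℤ.* w ℤ.* z ≈ w ℤ.* w ℤ.- + 1 [ n ]
    linear w z (mk≈ n∣) = mk≈ (∣-multiple (ℤ.- + 1) n∣ (identity w z))
      where identity : ∀ w z → + 2 ℤ.* w ℤ.* z ℤ.- (w ℤ.* w ℤ.- + 1) ≡ ℤ.- + 1 ℤ.* ((w ℤ.- z) ℤ.* (w ℤ.- z) ℤ.- + 1 ℤ.- z ℤ.* z)
            identity = ℤ-Solver.solve-∀
    linear⁻¹ : ∀ w z → + 2 ℤ.* w ℤ.* z ≈ w ℤ.* w ℤ.- + 1 [ n ] → (w ℤ.- z) ℤ.* (w ℤ.- z) ℤ.- + 1 ≈ z ℤ.* z [ n ]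
    linear⁻¹ w z (mk≈ n∣) = mk≈ (∣-multiple (ℤ.- + 1) n∣ (identity w z))
      where identity : ∀ w z → (w ℤ.- z) ℤ.* (w ℤ.- z) ℤ.- + 1 ℤ.- z ℤ.* z ≡ ℤ.- + 1 ℤ.* (+ 2 ℤ.* w ℤ.* z ℤ.- (w ℤ.* w ℤ.- + 1))
            identity = ℤ-Solver.solve-∀
    fibre : ∀ w → Dec (Unit w) → ∑ᶻ n (λ z → solution (w ℤ.- z) z) ≡ 𝟙 (good? w)
    fibre w (no ¬uw) = trans (∑-zero n λ k → trans (cong (υ (w ℤ.- + k) *_) (trans (cong (υ (+ k) *_) (no-solution (+ k))) (*-zeroʳ (υ (+ k))))) (*-zeroʳ (υ (w ℤ.- + k))))
                             (sym (𝟙-no (good? w) (¬uw ∘ proj₁)))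
      where
      no-solution : ∀ z → 𝟙 ((w ℤ.- z) ℤ.* (w ℤ.- z) ℤ.- + 1 ≈? z ℤ.* z [ n ]) ≡ 0
      no-solution z = 𝟙-no ((w ℤ.- z) ℤ.* (w ℤ.- z) ℤ.- + 1 ≈? z ℤ.* z [ n ]) λ eq →
        -- If p divided w, then 2wz ≡ w² - 1 would make p divide 1.
        ¬uw λ p∣w → Unit-1 (∣-combination (w ℤ.- + 2 ℤ.* z) (+ 1) p∣w (n∣a-b (mod-p (linear w z eq))) (identity w z))
        where identity : ∀ w z → + 1 ≡ (w ℤ.- + 2 ℤ.* z) ℤ.* w ℤ.+ + 1 ℤ.* (+ 2 ℤ.* w ℤ.* z ℤ.- (w ℤ.* w ℤ.- + 1))
              identity = ℤ-Solver.solve-∀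
    fibre w (yes uw) = begin
      ∑ᶻ n (λ z → υ (w ℤ.- z) * (υ z * 𝟙 ((w ℤ.- z) ℤ.* (w ℤ.- z) ℤ.- + 1 ≈? z ℤ.* z [ n ])))
        ≡⟨ ∑-cong n (λ k → trans (rearrange (υ (w ℤ.- + k)) (υ (+ k)) _) (cong (_* (υ (w ℤ.- + k) * υ (+ k))) (solve (+ k)))) ⟩
      ∑ᶻ n (λ z → 𝟙 (z ≈? z₀ [ n ]) * (υ (w ℤ.- z) * υ z))
        ≡⟨ ∑ᶻ-δ n {λ z → υ (w ℤ.- z) * υ z} (λ a≈b → cong₂ _*_ (υ-periodic (minus-cong-≈ {a = w} ≈-refl a≈b)) (υ-periodic a≈b)) z₀ ⟩
      υ (w ℤ.- z₀) * υ z₀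
        ≡⟨ 𝟙-× (unit? (w ℤ.- z₀)) (unit? z₀) ⟨
      𝟙 (unit? (w ℤ.- z₀) ×-dec unit? z₀)
        ≡⟨ 𝟙-⇔ (unit? (w ℤ.- z₀) ×-dec unit? z₀) (good? w) to from ⟩
      𝟙 (good? w) ∎
      where
      rearrange : ∀ a b c → a * (b * c) ≡ c * (a * b)
      rearrange = ℕ-Solver.solve-∀
      u2w : Unit (+ 2 ℤ.* w)
      u2w = Unit-* Unit-2 uw
      v = proj₁ (inverse u2w)
      z₀ = v ℤ.* (w ℤ.* w ℤ.- + 1)
      2wz₀≈w²-1 : + 2 ℤ.* w ℤ.* z₀ ≈ w ℤ.* w ℤ.- + 1 [ n ]
      2wz₀≈w²-1 = ≈-trans (≈-reflexive (sym (ℤ.*-assoc (+ 2 ℤ.* w) v (w ℤ.* w ℤ.- + 1))))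
        (≈-trans (*-cong-≈ (proj₂ (inverse u2w)) ≈-refl) (≈-reflexive (ℤ.*-identityˡ (w ℤ.* w ℤ.- + 1))))
      2w[w-z₀]≈w²+1 : + 2 ℤ.* w ℤ.* (w ℤ.- z₀) ≈ w ℤ.* w ℤ.+ + 1 [ n ]
      2w[w-z₀]≈w²+1 = mk≈ (∣-multiple (ℤ.- + 1) (n∣a-b 2wz₀≈w²-1) (identity w z₀))
        where identity : ∀ w z → + 2 ℤ.* w ℤ.* (w ℤ.- z) ℤ.- (w ℤ.* w ℤ.+ + 1) ≡ ℤ.- + 1 ℤ.* (+ 2 ℤ.* w ℤ.* z ℤ.- (w ℤ.* w ℤ.- + 1))
              identity = ℤ-Solver.solve-∀
      solve : ∀ z → 𝟙 ((w ℤ.- z) ℤ.* (w ℤ.- z) ℤ.- + 1 ≈? z ℤ.* z [ n ]) ≡ 𝟙 (z ≈? z₀ [ n ])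
      solve z = 𝟙-⇔ ((w ℤ.- z) ℤ.* (w ℤ.- z) ℤ.- + 1 ≈? z ℤ.* z [ n ]) (z ≈? z₀ [ n ])
        (λ eq → *-cancelˡ-≈ u2w (≈-trans (linear w z eq) (≈-sym 2wz₀≈w²-1)))
        (λ z≈z₀ → linear⁻¹ w z (≈-trans (*-cong-≈ {a = + 2 ℤ.* w} ≈-refl z≈z₀) 2wz₀≈w²-1))
      to : Unit (w ℤ.- z₀) × Unit z₀ → Good w
      to (ux , uz) = uw , Unit-resp 2w[w-z₀]≈w²+1 (Unit-* u2w ux) , Unit-resp 2wz₀≈w²-1 (Unit-* u2w uz)
      from : Good w → Unit (w ℤ.- z₀) × Unit z₀
      from (_ , uw²+1 , uw²-1) = Unit-*⁻ʳ (+ 2 ℤ.* w) (Unit-resp (≈-sym 2w[w-z₀]≈w²+1) uw²+1) ,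
                                 Unit-*⁻ʳ (+ 2 ℤ.* w) (Unit-resp (≈-sym 2wz₀≈w²-1) uw²-1)

  -- Triangles with one vertex at 0, reduced to the conic.

  ∑-scale : ∀ {y} → Unit y → ∀ {F} → Periodic n F → ∑ᶻ n (λ x → F (y ℤ.* x)) ≡ ∑ᶻ n F
  ∑-scale {y} uy = ∑ᶻ-permute n (y ℤ.*_) (v ℤ.*_)
    (λ {x} {z} z≈yx → *-cancelˡ-≈ {y} uy (≈-trans (≈-sym z≈yx) (≈-sym (y[vz]≈z z))))
    (λ {x} {z} x≈vz → ≈-sym (≈-trans (*-cong-≈ {a = y} ≈-refl x≈vz) (y[vz]≈z z)))
    where
    v = proj₁ (inverse uy)
    y[vz]≈z : ∀ z → y ℤ.* (v ℤ.* z) ≈ z [ n ]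
    y[vz]≈z z = ≈-trans (≈-reflexive (sym (ℤ.*-assoc y v z)))
      (≈-trans (*-cong-≈ (proj₂ (inverse uy)) ≈-refl) (≈-reflexive (ℤ.*-identityˡ z)))

  ∑-shift : ∀ c {F} → Periodic n F → ∑ᶻ n (λ x → F (x ℤ.+ c)) ≡ ∑ᶻ n F
  ∑-shift c = ∑ᶻ-permute n (ℤ._+ c) (ℤ._- c)
    (λ {x} {y} y≈x+c → ≈-sym (≈-trans (minus-cong-≈ y≈x+c ≈-refl) (≈-reflexive (cancel x c))))
    (λ {x} {y} x≈y-c → ≈-sym (≈-trans (+-cong-≈ x≈y-c ≈-refl) (≈-reflexive (cancel′ y c))))
    where
    cancel : ∀ x c → x ℤ.+ c ℤ.- c ≡ x
    cancel = ℤ-Solver.solve-∀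
    cancel′ : ∀ y c → y ℤ.- c ℤ.+ c ≡ y
    cancel′ = ℤ-Solver.solve-∀

  ∑-periodic : ∀ (F : ℤ → ℤ → ℕ) → (∀ y → Periodic n (λ x → F x y)) → Periodic n (λ x → ∑ᶻ n (F x))
  ∑-periodic F F-per a≈b = ∑-cong n λ j → F-per (+ j) a≈b

  υ-* : ∀ {y} x → Unit y → υ (y ℤ.* x) ≡ υ x
  υ-* {y} x uy = 𝟙-⇔ (unit? (y ℤ.* x)) (unit? x) (Unit-*⁻ʳ y) (Unit-* uy)

  -- Here 8 = 2³. The 2's of χ b and χ a turn these variables into squares y² and x² of units; the
  -- third counts the roots z of x² - y². Scaling by y makes the inner count the same for all φ(n)
  -- units y.
  ∑-differences : 8 * ∑ᶻ n (λ b → ∑ᶻ n (λ a → χ b * (χ a * χ (a ℤ.- b)))) ≡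
                  p ^ β * (p ∸ 1) * (p ^ β * (p ∸ 5))
  ∑-differences = begin
    8 * ∑ᶻ n (λ b → ∑ᶻ n (λ a → χ b * (χ a * χ (a ℤ.- b))))
      ≡⟨ ∑-*ˡ n 8 _ ⟨
    ∑ᶻ n (λ b → 8 * ∑ᶻ n (λ a → χ b * (χ a * χ (a ℤ.- b))))
      ≡⟨ ∑-cong n (λ j → trans (sym (∑-*ˡ n 8 _)) (∑-cong n λ i → distribute (χ (+ j)) (χ (+ i)) _)) ⟩
    ∑ᶻ n (λ b → ∑ᶻ n (λ a → 2 * χ b * (2 * χ a * (2 * χ (a ℤ.- b)))))
      ≡⟨ ∑-cong n (λ j → trans (∑-*ˡ n (2 * χ (+ j)) _) (cong (2 * χ (+ j) *_) (∑-squares {λ a → 2 * χ (a ℤ.- + j)} (λ a≈b → cong (2 *_) (χ-periodic (minus-cong-≈ {c = + j} a≈b ≈-refl)))))) ⟩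
    ∑ᶻ n (λ b → 2 * χ b * H b)
      ≡⟨ ∑-squares {H} H-periodic ⟩
    ∑ᶻ n (λ y → υ y * H (y ℤ.* y))
      -- Scaling is possible only for a unit y; the weight υ y removes all other terms.
      ≡⟨ ∑-cong n (λ j → 𝟙-*-cong (unit? (+ j)) (H-square (+ j))) ⟩
    ∑ᶻ n (λ y → υ y * ∑ᶻ n (λ x → ∑ᶻ n (solution x)))
      ≡⟨ ∑-*ʳ n (∑ᶻ n (λ x → ∑ᶻ n (solution x))) υ₊ ⟩
    ∑ᶻ n υ * ∑ᶻ n (λ x → ∑ᶻ n (solution x))
      ≡⟨ cong₂ _*_ ∑-υ ∑-solutions ⟩
    p ^ β * (p ∸ 1) * (p ^ β * (p ∸ 5)) ∎
    where
    open ≡-Reasoning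
    υ₊ : ℕ → ℕ
    υ₊ k = υ (+ k)
    distribute : ∀ a b c → 8 * (a * (b * c)) ≡ 2 * a * (2 * b * (2 * c))
    distribute = ℕ-Solver.solve-∀
    H : ℤ → ℕ
    H b = ∑ᶻ n (λ x → υ x * (2 * χ (x ℤ.* x ℤ.- b)))
    H-periodic : Periodic n H
    H-periodic = ∑-periodic (λ b x → υ x * (2 * χ (x ℤ.* x ℤ.- b))) λ x a≈b →
      cong (λ s → υ x * (2 * s)) (χ-periodic (minus-cong-≈ {a = x ℤ.* x} ≈-refl a≈b))
    -- The substitution (x , z) ↦ (yx , yz) turns x² - y² = z² into x² - 1 = z².
    H-square : ∀ y → Unit y → H (y ℤ.* y) ≡ ∑ᶻ n (λ x → ∑ᶻ n (solution x))
    H-square y uy = begin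
      ∑ᶻ n (λ x → υ x * (2 * χ (x ℤ.* x ℤ.- y ℤ.* y)))
        ≡⟨ ∑-scale uy {λ x → υ x * (2 * χ (x ℤ.* x ℤ.- y ℤ.* y))} (λ a≈b → cong₂ _*_ (υ-periodic a≈b) (cong (2 *_) (χ-periodic (minus-cong-≈ {c = y ℤ.* y} (*-cong-≈ a≈b a≈b) ≈-refl)))) ⟨
      ∑ᶻ n (λ x → υ (y ℤ.* x) * (2 * χ (y ℤ.* x ℤ.* (y ℤ.* x) ℤ.- y ℤ.* y)))
        ≡⟨ ∑-cong n (λ i → row (+ i)) ⟩
      ∑ᶻ n (λ x → ∑ᶻ n (solution x)) ∎
      where
      row : ∀ x → υ (y ℤ.* x) * (2 * χ (y ℤ.* x ℤ.* (y ℤ.* x) ℤ.- y ℤ.* y)) ≡ ∑ᶻ n (solution x)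
      row x = begin
        υ (y ℤ.* x) * (2 * χ d)
          ≡⟨ cong₂ _*_ (υ-* x uy) (sym (∑-roots d)) ⟩
        υ x * ∑ᶻ n (λ z → υ z * 𝟙 (d ≈? z ℤ.* z [ n ]))
          ≡⟨ cong (υ x *_) (∑-scale uy {λ z → υ z * 𝟙 (d ≈? z ℤ.* z [ n ])} (λ a≈b → cong₂ _*_ (υ-periodic a≈b)
               (𝟙-periodic (λ z → d ≈? z ℤ.* z [ n ]) (λ a≈b d≈a² → ≈-trans d≈a² (*-cong-≈ a≈b a≈b)) a≈b))) ⟨
        υ x * ∑ᶻ n (λ z → υ (y ℤ.* z) * 𝟙 (d ≈? y ℤ.* z ℤ.* (y ℤ.* z) [ n ]))
          ≡⟨ cong (υ x *_) (∑-cong n λ k → cong₂ _*_ (υ-* (+ k) uy) (𝟙-⇔ (d ≈? y ℤ.* + k ℤ.* (y ℤ.* + k) [ n ]) (x ℤ.* x ℤ.- + 1 ≈? + k ℤ.* + k [ n ]) (to (+ k)) (from (+ k)))) ⟩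
        υ x * ∑ᶻ n (λ z → υ z * 𝟙 (x ℤ.* x ℤ.- + 1 ≈? z ℤ.* z [ n ]))
          ≡⟨ ∑-*ˡ n (υ x) _ ⟨
        ∑ᶻ n (solution x) ∎
        where
        d = y ℤ.* x ℤ.* (y ℤ.* x) ℤ.- y ℤ.* y
        factor-left : ∀ x y → y ℤ.* x ℤ.* (y ℤ.* x) ℤ.- y ℤ.* y ≡ y ℤ.* y ℤ.* (x ℤ.* x ℤ.- + 1)
        factor-left = ℤ-Solver.solve-∀
        factor-right : ∀ y z → y ℤ.* z ℤ.* (y ℤ.* z) ≡ y ℤ.* y ℤ.* (z ℤ.* z)
        factor-right = ℤ-Solver.solve-∀
        to : ∀ z → d ≈ y ℤ.* z ℤ.* (y ℤ.* z) [ n ] → x ℤ.* x ℤ.- + 1 ≈ z ℤ.* z [ n ]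
        to z eq = *-cancelˡ-≈ {y ℤ.* y} (Unit-* uy uy) (subst₂ (_≈_[ n ]) (factor-left x y) (factor-right y z) eq)
        from : ∀ z → x ℤ.* x ℤ.- + 1 ≈ z ℤ.* z [ n ] → d ≈ y ℤ.* z ℤ.* (y ℤ.* z) [ n ]
        from z eq = subst₂ (_≈_[ n ]) (sym (factor-left x y)) (sym (factor-right y z)) (*-cong-≈ {a = y ℤ.* y} ≈-refl eq)

  -- Counting triangles.

  triangle : ℕ → ℕ → ℕ → ℕ
  triangle a b c = χ (+ a ℤ.- + b) * (χ (+ a ℤ.- + c) * χ (+ b ℤ.- + c))

  -- Unit squares are closed under products and -1 is one of them, so d and -d are squares together;
  -- this is the symmetry of adjacency.
  χ-neg : ∀ d → χ (ℤ.- d) ≡ χ d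
  χ-neg d = 𝟙-⇔ (square? (ℤ.- d)) (square? d)
    (λ sq → subst Square (neg-neg d) (Square-* Square--1 sq))
    (λ sq → subst Square (ℤ.-1*i≡-i d) (Square-* Square--1 sq))
    where neg-neg : ∀ d → ℤ.- + 1 ℤ.* ℤ.- d ≡ d
          neg-neg = ℤ-Solver.solve-∀

  χ-swap : ∀ a b → χ (a ℤ.- b) ≡ χ (b ℤ.- a)
  χ-swap a b = trans (cong χ (identity a b)) (χ-neg (b ℤ.- a))
    where identity : ∀ a b → a ℤ.- b ≡ ℤ.- (b ℤ.- a)
          identity = ℤ-Solver.solve-∀

  triangle-sym₁₂ : ∀ a b c → triangle a b c ≡ triangle b a c
  triangle-sym₁₂ a b c = cong₂ _*_ (χ-swap (+ a) (+ b)) (*-comm (χ (+ a ℤ.- + c)) _)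

  triangle-sym₂₃ : ∀ a b c → triangle a b c ≡ triangle a c b
  triangle-sym₂₃ a b c = trans (cong (λ s → χ (+ a ℤ.- + b) * (χ (+ a ℤ.- + c) * s)) (χ-swap (+ b) (+ c)))
    (rearrange (χ (+ a ℤ.- + b)) (χ (+ a ℤ.- + c)) _)
    where rearrange : ∀ x y z → x * (y * z) ≡ y * (x * z)
          rearrange = ℕ-Solver.solve-∀

  triangle-diag : ∀ a c → triangle a a c ≡ 0
  triangle-diag a c = cong (_* (χ (+ a ℤ.- + c) * χ (+ a ℤ.- + c)))
    (𝟙-no (square? (+ a ℤ.- + a)) λ sq → ¬Unit-0 (subst Unit (ℤ.+-inverseʳ (+ a)) (Square⇒Unit sq)))

  K3-∑ : K3 n ≡ ∑ n (λ c → ∑ c (λ b → ∑ b (λ a → triangle a b c)))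
  K3-∑ = trans (length-filter-concatMap (isTriangle? n) _ n) (∑-cong-< n λ c c<n →
    trans (length-filter-concatMap (isTriangle? n) _ c) (∑-cong-< c λ b b<c →
    trans (length-filter-map (isTriangle? n) _ b) (∑-cong-< b λ a a<b →
    -- The subtracted vertices b and c must lie below n, where `diffMod` is a true difference.
    indicator a (<-trans b<c c<n) c<n)))
    where
    open ≡-Reasoning
    adj-indicator : ∀ a {b} → b < n → 𝟙 (adj? n a b) ≡ χ (+ a ℤ.- + b)
    adj-indicator a {b} b<n = 𝟙-⇔ (adj? n a b) (square? (+ a ℤ.- + b)) (Adj⇒Square b<n) (Square⇒Adj b<n)
    indicator : ∀ a {b c} → b < n → c < n → 𝟙 (isTriangle? n (a , b , c)) ≡ triangle a b c
    indicator a {b} {c} b<n c<n = begin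
      𝟙 (adj? n a b ×-dec (adj? n a c ×-dec adj? n b c))
        ≡⟨ 𝟙-× (adj? n a b) (adj? n a c ×-dec adj? n b c) ⟩
      𝟙 (adj? n a b) * 𝟙 (adj? n a c ×-dec adj? n b c)
        ≡⟨ cong (𝟙 (adj? n a b) *_) (𝟙-× (adj? n a c) (adj? n b c)) ⟩
      𝟙 (adj? n a b) * (𝟙 (adj? n a c) * 𝟙 (adj? n b c))
        ≡⟨ cong₂ _*_ (adj-indicator a b<n) (cong₂ _*_ (adj-indicator a c<n) (adj-indicator b c<n)) ⟩
      triangle a b c ∎

  -- Translation by c replaces b by b - c in the outer sum and a by a - c in the inner one, leaving
  -- a - b unchanged. The result is the same for every c, so summing over c contributes the factor
  -- n.
  ∑-triangle : ∀ c → ∑ n (λ b → ∑ n (λ a → triangle a b c)) ≡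
                     ∑ᶻ n (λ b → ∑ᶻ n (λ a → χ b * (χ a * χ (a ℤ.- b))))
  ∑-triangle c = begin
    ∑ᶻ n (λ b → ∑ᶻ n (λ a → χ (a ℤ.- b) * (χ (a ℤ.- + c) * χ (b ℤ.- + c))))
      ≡⟨ ∑-cong n (λ j → row (+ j)) ⟩
    ∑ᶻ n (λ b → G (b ℤ.- + c))
      ≡⟨ ∑-shift (ℤ.- + c) {G} G-periodic ⟩
    ∑ᶻ n G ∎
    where
    open ≡-Reasoning
    G : ℤ → ℕ
    G b = ∑ᶻ n (λ a → χ b * (χ a * χ (a ℤ.- b)))
    G-periodic : Periodic n G
    G-periodic = ∑-periodic (λ b a → χ b * (χ a * χ (a ℤ.- b))) λ a b≈b′ →
      cong₂ (λ s t → s * (χ a * t)) (χ-periodic b≈b′) (χ-periodic (minus-cong-≈ {a = a} ≈-refl b≈b′))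
    translate : ∀ a b c → a ℤ.- b ≡ a ℤ.- c ℤ.- (b ℤ.- c)
    translate = ℤ-Solver.solve-∀
    rearrange : ∀ x y z → x * (y * z) ≡ z * (y * x)
    rearrange = ℕ-Solver.solve-∀
    row : ∀ b → ∑ᶻ n (λ a → χ (a ℤ.- b) * (χ (a ℤ.- + c) * χ (b ℤ.- + c))) ≡ G (b ℤ.- + c)
    row b = begin
      ∑ᶻ n (λ a → χ (a ℤ.- b) * (χ (a ℤ.- + c) * χ (b ℤ.- + c)))
        ≡⟨ ∑-cong n (λ i → trans (cong (λ d → χ d * (χ (+ i ℤ.- + c) * χ (b ℤ.- + c))) (translate (+ i) b (+ c)))
                                 (rearrange (χ (+ i ℤ.- + c ℤ.- (b ℤ.- + c))) (χ (+ i ℤ.- + c)) (χ (b ℤ.- + c)))) ⟩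
      ∑ᶻ n (λ a → χ (b ℤ.- + c) * (χ (a ℤ.- + c) * χ (a ℤ.- + c ℤ.- (b ℤ.- + c))))
        ≡⟨ ∑-shift (ℤ.- + c) {λ a → χ (b ℤ.- + c) * (χ a * χ (a ℤ.- (b ℤ.- + c)))} (λ a≈a′ → cong₂ (λ s t → χ (b ℤ.- + c) * (s * t)) (χ-periodic a≈a′) (χ-periodic (minus-cong-≈ {c = b ℤ.- + c} a≈a′ ≈-refl))) ⟩
      G (b ℤ.- + c) ∎

  -- The 6 in 48 = 6 · 8 passes from increasing triples to all triples, the 8 from squares to their
  -- roots. The exponent collects β + 1 from n and β from each of the two counts: 3β + 1 = 3 (β + 1)
  -- - 2.
  K3*48 : K3 n * 48 ≡ p ^ (3 * suc β ∸ 2) * (p ∸ 1) * (p ∸ 5)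
  K3*48 = begin
    K3 n * 48
      ≡⟨ cong (_* 48) K3-∑ ⟩
    below * 48
      ≡⟨ rearrange₁ below ⟩
    8 * (6 * below)
      ≡⟨ cong (8 *_) (∑-symmetric₃ n triangle triangle-sym₁₂ triangle-sym₂₃ triangle-diag) ⟨
    8 * ∑ n (λ c → ∑ n (λ b → ∑ n (λ a → triangle a b c)))
      ≡⟨ cong (8 *_) (trans (∑-cong n ∑-triangle) (∑-const n differences)) ⟩
    8 * (n * differences)
      ≡⟨ rearrange₂ n differences ⟩
    n * (8 * differences)
      ≡⟨ cong (n *_) ∑-differences ⟩
    p * p ^ β * (p ^ β * (p ∸ 1) * (p ^ β * (p ∸ 5)))
      ≡⟨ rearrange₃ p (p ^ β) (p ∸ 1) (p ∸ 5) ⟩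
    p * (p ^ β * (p ^ β * p ^ β)) * (p ∸ 1) * (p ∸ 5)
      ≡⟨ cong (λ q → p * q * (p ∸ 1) * (p ∸ 5)) (trans (cong (p ^ β *_) (sym (^-distribˡ-+-* p β β))) (sym (^-distribˡ-+-* p β (β + β)))) ⟩
    p ^ suc (β + (β + β)) * (p ∸ 1) * (p ∸ 5)
      ≡⟨ cong (λ e → p ^ e * (p ∸ 1) * (p ∸ 5)) exponent ⟨
    p ^ (3 * suc β ∸ 2) * (p ∸ 1) * (p ∸ 5) ∎
    where
    open ≡-Reasoning
    below = ∑ n (λ c → ∑ c (λ b → ∑ b (λ a → triangle a b c)))
    differences = ∑ᶻ n (λ b → ∑ᶻ n (λ a → χ b * (χ a * χ (a ℤ.- b))))
    rearrange₁ : ∀ x → x * 48 ≡ 8 * (6 * x)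
    rearrange₁ = ℕ-Solver.solve-∀
    rearrange₂ : ∀ x y → 8 * (x * y) ≡ x * (8 * y)
    rearrange₂ = ℕ-Solver.solve-∀
    rearrange₃ : ∀ p q a b → p * q * (q * a * (q * b)) ≡ p * (q * (q * q)) * a * b
    rearrange₃ = ℕ-Solver.solve-∀
    expand : ∀ β → 3 * suc β ≡ suc (β + (β + β)) + 2
    expand = ℕ-Solver.solve-∀
    exponent : 3 * suc β ∸ 2 ≡ suc (β + (β + β))
    exponent = trans (cong (_∸ 2) (expand β)) (m+n∸n≡m (suc (β + (β + β))) 2)

theorem1p1 : (p α : ℕ) → (pp : Prime p) → p % 4 ≡ 1 → 1 ≤ α →
    K3 (p ^ α) {{m^n≢0 p α {{prime⇒nonZero pp}}}} ≡ (p ^ (3 * α ∸ 2) * (p ∸ 1) * (p ∸ 5)) / 48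
-- The product formula exhibits the numerator as a multiple of 48, so the integer division is exact.
theorem1p1 p (suc β) pp p%4≡1 _ = trans (sym (m*n/n≡m (K3 n) 48)) (cong (_/ 48) K3*48)
  where
  open PrimePower p pp p%4≡1 β
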